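{- Let $R$ be a connected graph with vertices $v_1,\dots,v_r$, let $H$ be a rooted graph on $n$ vertices, let $\alpha\in[0,1]$, and let $\rho_1(\alpha),\dots,\rho_r(\alpha)$ be the eigenvalues (with multiplicity) of $A_\alpha(R)$. Then, as multisets, \[ \mathrm{Spec}\big(A_\alpha(R\{H\})\big)=\bigcup_{j=1}^{r}\mathrm{Spec}\big(A_\alpha(H)+\rho_j(\alpha)E\big). \]
   Context: For a graph $G$ and $\alpha\in[0,1]$, $A_\alpha(G)=\alpha D(G)+(1-\alpha)A(G)$, where $D(G)$ is the diagonal matrix of vertex degrees and $A(G)$ the adjacency matrix. For a connected graph $R$ on vertices $v_1,\dots,v_r$ and a rooted graph $H$, $R\{H\}$ is the graph obtained from $R$ and $r$ copies of $H$ by identifying the root of the $i$-th copy of $H$ with $v_i$, for each $i$. Vertices of $H$ are ordered so that the root is the last ($n$-th) vertex, and $E$ is the $n\times n$ matrix with $1$ in entry $(n,n)$ (the root's diagonal position) and zeros elsewhere. $\mathrm{Spec}(M)$ denotes the multiset of eigenvalues of $M$, and unions of spectra are multiset unions. -}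

module Defs where

open import Level using (Level; 0ℓ; _⊔_) renaming (suc to lsuc)
open import Algebra.Bundles using (CommutativeRing)
open import Algebra.Bundles.Raw using (RawRing)
import Algebra.Definitions.RawMonoid as RawMonoidOps
open import Data.Bool.Base using (if_then_else_)
open import Data.Fin.Base using (Fin; zero; suc; toℕ; fromℕ; punchIn; remQuot)
open import Data.Fin.Properties using (_≟_)
open import Data.List.Base using (List; []; _∷_; map; foldr; filter; length; allFin)
import Data.List.Relation.Binary.Permutation.Setoid as SetoidPermutation
open import Data.Nat.Base using (ℕ; zero; suc; NonZero) renaming (_*_ to _*ℕ_)
open import Data.Product.Base using (Σ; _×_; _,_; proj₁; proj₂)
open import Data.Sum.Base using (_⊎_; inj₁; inj₂)
open import Relation.Binary.Core using (Rel)
open import Relation.Binary.Construct.Closure.ReflexiveTransitive using (Star)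
open import Relation.Binary.Definitions using (Decidable; Symmetric; Irreflexive)
open import Relation.Binary.PropositionalEquality.Core using (_≡_; sym)
open import Relation.Binary.Structures using (IsDecTotalOrder)
open import Relation.Nullary.Decidable.Core using (does; _×-dec_; _⊎-dec_)
open import Relation.Nullary.Negation.Core using (¬_)

record Graph (n : ℕ) : Set₁ where
  field
    Adj    : Rel (Fin n) 0ℓ
    Adj?   : Decidable Adj
    symm   : Symmetric Adj
    irrefl : Irreflexive _≡_ Adj

  degree : Fin n → ℕ
  degree v = length (filter (Adj? v) (allFin n))

Connected : ∀ {n} → Graph n → Set
Connected {n} G = NonZero n × (∀ u v → Star (Graph.Adj G) u v)

-- A rooted graph is a graph on Fin (suc m) whose root is its last vertex.

root : ∀ {m} → Fin (suc m)
root {m} = fromℕ m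

-- R ｛ H ｝ : through remQuot, a vertex is a pair (i , h), namely the
-- vertex h of the i-th copy of H; the pair (i , root) is also the vertex
-- vᵢ of R.

module _ {r m : ℕ} (R : Graph r) (H : Graph (suc m)) where

  private
    module R = Graph R
    module H = Graph H

  RootedAdj : Rel (Fin r × Fin (suc m)) 0ℓ
  RootedAdj (i , h) (j , k) =
    (i ≡ j × H.Adj h k) ⊎ (R.Adj i j × h ≡ root × k ≡ root)

  rootedAdj? : Decidable RootedAdj
  rootedAdj? (i , h) (j , k) =
    ((i ≟ j) ×-dec H.Adj? h k) ⊎-dec (R.Adj? i j ×-dec ((h ≟ root) ×-dec (k ≟ root)))

  rootedAdj-sym : Symmetric RootedAdj
  rootedAdj-sym (inj₁ (i≡j , hk))       = inj₁ (sym i≡j , H.symm hk)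
  rootedAdj-sym (inj₂ (ij , h≡o , k≡o)) = inj₂ (R.symm ij , k≡o , h≡o)

  rootedAdj-irrefl : Irreflexive _≡_ RootedAdj
  rootedAdj-irrefl _≡_.refl (inj₁ (_ , hh)) = H.irrefl _≡_.refl hh
  rootedAdj-irrefl _≡_.refl (inj₂ (ii , _)) = R.irrefl _≡_.refl ii

  infix 9 _｛_｝
  _｛_｝ : Graph (r *ℕ suc m)
  _｛_｝ = record
    { Adj    = λ p q → RootedAdj (vertex p) (vertex q)
    ; Adj?   = λ p q → rootedAdj? (vertex p) (vertex q)
    ; symm   = rootedAdj-sym
    ; irrefl = λ p≡q → rootedAdj-irrefl (cong-vertex p≡q)
    }
    where
    vertex : Fin (r *ℕ suc m) → Fin r × Fin (suc m)
    vertex = remQuot (suc m)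

    cong-vertex : ∀ {p q} → p ≡ q → vertex p ≡ vertex q
    cong-vertex _≡_.refl = _≡_.refl

Matrix : ∀ {a} → Set a → ℕ → Set a
Matrix A n = Fin n → Fin n → A

module Determinant {c ℓ} (S : RawRing c ℓ) where
  open RawRing S
  open RawMonoidOps +-rawMonoid using (sum)

  sign : ℕ → Carrier
  sign zero    = 1#
  sign (suc k) = - sign k

  -- Laplace expansion along row 0.
  det : ∀ {n} → Matrix Carrier n → Carrier
  det {zero}  M = 1#
  det {suc n} M = sum λ j →
    sign (toℕ j) * (M zero j * det (λ i k → M (suc i) (punchIn j k)))

-- Polynomials as coefficient lists, constant term first; trailing zeros are
-- allowed, so equality compares all coefficients.

module Polynomial {c ℓ} (K : CommutativeRing c ℓ) where
  open CommutativeRing K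

  Poly : Set c
  Poly = List Carrier

  coeff : Poly → ℕ → Carrier
  coeff []      _       = 0#
  coeff (a ∷ _) zero    = a
  coeff (_ ∷ p) (suc k) = coeff p k

  infix 4 _≈ᴾ_
  _≈ᴾ_ : Rel Poly ℓ
  p ≈ᴾ q = ∀ k → coeff p k ≈ coeff q k

  infixl 6 _+ᴾ_
  _+ᴾ_ : Poly → Poly → Poly
  []      +ᴾ q       = q
  (a ∷ p) +ᴾ []      = a ∷ p
  (a ∷ p) +ᴾ (b ∷ q) = (a + b) ∷ (p +ᴾ q)

  infixl 7 _*ᴾ_
  _*ᴾ_ : Poly → Poly → Poly
  []      *ᴾ q = []
  (a ∷ p) *ᴾ q = map (a *_) q +ᴾ (0# ∷ (p *ᴾ q))

  -ᴾ_ : Poly → Poly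
  -ᴾ p = map -_ p

  constant : Carrier → Poly
  constant a = a ∷ []

  X : Poly
  X = 0# ∷ 1# ∷ []

  polyRawRing : RawRing c ℓ
  polyRawRing = record
    { Carrier = Poly
    ; _≈_     = _≈ᴾ_
    ; _+_     = _+ᴾ_
    ; _*_     = _*ᴾ_
    ; -_      = -ᴾ_
    ; 0#      = []
    ; 1#      = constant 1#
    }

-- The real numbers enter the statement through their ordered-field
-- structure only. The order, hence also equality, is decidable, as it is
-- classically for ℝ. No completeness is assumed.

record OrderedField c ℓ₁ ℓ₂ : Set (lsuc (c ⊔ ℓ₁ ⊔ ℓ₂)) where
  infix 4 _≤_
  field
    commutativeRing : CommutativeRing c ℓ₁
  open CommutativeRing commutativeRing public
  field
    _≤_             : Rel Carrier ℓ₂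
    isDecTotalOrder : IsDecTotalOrder _≈_ _≤_
    +-monoˡ-≤       : ∀ {x y} z → x ≤ y → x + z ≤ y + z
    *-nonneg        : ∀ {x y} → 0# ≤ x → 0# ≤ y → 0# ≤ x * y
    0≉1             : ¬ 0# ≈ 1#
    inverse         : ∀ x → ¬ x ≈ 0# → Σ Carrier λ y → x * y ≈ 1#

module Spectra {c ℓ₁ ℓ₂} (K : OrderedField c ℓ₁ ℓ₂) where
  open OrderedField K
  open RawMonoidOps +-rawMonoid using () renaming (_×_ to _×ᴺ_)
  open Polynomial commutativeRing
  open SetoidPermutation setoid public using (_↭_)

  infixl 6 _+ᴹ_
  _+ᴹ_ : ∀ {n} → Matrix Carrier n → Matrix Carrier n → Matrix Carrier n
  (M +ᴹ N) i j = M i j + N i j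

  infixr 7 _·ᴹ_
  _·ᴹ_ : ∀ {n} → Carrier → Matrix Carrier n → Matrix Carrier n
  (a ·ᴹ M) i j = a * M i j

  adjacencyMatrix : ∀ {n} → Graph n → Matrix Carrier n
  adjacencyMatrix G i j = if does (Graph.Adj? G i j) then 1# else 0#

  degreeMatrix : ∀ {n} → Graph n → Matrix Carrier n
  degreeMatrix G i j = if does (i ≟ j) then Graph.degree G i ×ᴺ 1# else 0#

  A[_] : ∀ {n} → Carrier → Graph n → Matrix Carrier n
  A[ α ] G = α ·ᴹ degreeMatrix G +ᴹ (1# - α) ·ᴹ adjacencyMatrix G

  E : ∀ {m} → Matrix Carrier (suc m)
  E i j = if does ((i ≟ root) ×-dec (j ≟ root)) then 1# else 0#

  charPoly : ∀ {n} → Matrix Carrier n → Poly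
  charPoly M = Determinant.det polyRawRing λ i j →
    (if does (i ≟ j) then X else []) +ᴾ (-ᴾ constant (M i j))

  fromRoots : List Carrier → Poly
  fromRoots = foldr (λ a p → (X +ᴾ (-ᴾ constant a)) *ᴾ p) (constant 1#)

  -- Multisets of scalars are lists up to _↭_. IsSpec M σ says that the
  -- multiset σ is Spec(M): det (X I − M) = ∏ (X − λ), λ ranging over σ.
  IsSpec : ∀ {n} → Matrix Carrier n → List Carrier → Set ℓ₁
  IsSpec M σ = charPoly M ≈ᴾ fromRoots σ

-- A_α(R{H}) equals I ⊗ A_α(H) + A_α(R) ⊗ E. Put P = X I − A_α(H)
-- and B = A_α(R) over K[X], let f = det P, and let g be det P with the root row
-- replaced by that of the identity. By Cramer's rule a row q with q P = f e and
-- root entry g exists, where e is the root unit row. Replacing the root row of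
-- every block of I ⊗ P − B ⊗ E by its combination with coefficients q
-- multiplies the determinant by gʳ. The new root rows are those of
-- (f I − g B) ⊗ E; the determinant is alternating in f I − g B, so that
--     gʳ det (I ⊗ P − B ⊗ E) = gʳ det (f I − g B).
-- As g is monic it cancels. Homogenising det (X I − B) = ∏ (X − ρⱼ) gives
-- det (f I − g B) = ∏ (f − ρⱼ g), and f − ρⱼ g = det (P − ρⱼ E).
-- Hence the characteristic polynomial of R{H} is the product of those of
-- A_α(H) + ρⱼ E, and monic factors of a product of linear polynomials over a
-- field are again such products.

module Submission where

open import Defs
open import Level using (_⊔_)
open import Algebra.Bundles using (CommutativeRing)
open import Algebra.Morphism.Structures using (IsRingHomomorphism)
open import Data.Bool.Base using (Bool; true; false; if_then_else_; _∧_; _∨_)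
open import Data.Bool.Properties using (∧-zeroʳ)
open import Data.Empty using (⊥-elim)
open import Data.Fin.Base
  using (Fin; zero; suc; toℕ; punchIn; punchOut; _↑ˡ_; _↑ʳ_; splitAt; remQuot; quotRem; combine)
open import Data.Fin.Properties
  using (_≟_; any?; suc-injective; punchIn-injective; punchIn-punchOut; punchInᵢ≢i; splitAt-↑ˡ; splitAt-↑ʳ;
         splitAt⁻¹-↑ˡ; ↑ˡ-injective; remQuot-combine; combine-remQuot; combine-injectiveˡ)
open import Data.List.Base as List using (List; []; _∷_; _++_; map; length; filter; concat; tabulate)
open import Data.List.Properties using (length-tabulate)
open import Data.List.Relation.Binary.Pointwise.Base using (Pointwise; []; _∷_)
import Data.List.Relation.Binary.Permutation.Setoid as Permutation
import Data.List.Relation.Binary.Permutation.Setoid.Properties as PermutationProperties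
open import Data.Nat.Base using (ℕ; zero; suc; z≤n; s≤s) renaming (_+_ to _+ℕ_; _*_ to _*ℕ_; _≤_ to _≤ℕ_)
open import Data.Nat.Properties
  using (≤-refl; ≤-trans; m≤n+m; m≤m+n; n≤1+n; m≤n⇒m<n∨m≡n; +-monoʳ-≤; _≤?_; ≰⇒>)
open import Data.Product.Base using (Σ-syntax; _×_; _,_; map₂; proj₁; proj₂)
open import Data.Sum.Base as Sum using (_⊎_; inj₁; inj₂; [_,_]′)
open import Data.Vec.Functional using (Vector; foldr; insertAt; updateAt) renaming (_∷_ to _◂_)
open import Data.Vec.Functional.Properties
  using (insertAt-lookup; insertAt-punchIn; updateAt-updates; updateAt-minimal)
open import Function.Base using (_∘_; const)
open import Function.Bundles using (_⇔_; mk⇔)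
open import Relation.Binary.PropositionalEquality.Core as ≡ using (_≡_; _≢_)
open import Relation.Binary.Structures using (IsDecTotalOrder)
open import Relation.Nullary.Decidable using (does-⇔; dec-true; dec-false)
open import Relation.Nullary.Decidable.Core using (does; yes; no; _×-dec_)
open import Relation.Unary using (Pred; Decidable)
import Algebra.Definitions.RawMonoid as RawMonoidOps
import Algebra.Properties.AbelianGroup as AbelianGroupProperties
import Algebra.Properties.Group as GroupProperties
import Algebra.Properties.Monoid.Sum as MonoidSum
import Algebra.Properties.Ring as RingProperties
import Algebra.Properties.Semiring.Exp as SemiringExp
import Algebra.Properties.Semiring.Sum as SemiringSum
import Algebra.Solver.Ring.NaturalCoefficients.Default as SemiringSolver
import Relation.Binary.Reasoning.Setoid as SetoidReasoning

-- The quotient `f / g` is the Schur complement of the root entry of `P`: eliminating the other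
-- vertices of every copy should leave the matrix `(f / g) I - B` on the roots. Fractions and
-- inverses are absent from K[X], and this shapes the argument. The row `q` is taken from the
-- adjugate of `P`, which brings in the factor `f`, and the characteristic polynomial of `B` is
-- homogenised instead of being evaluated at `f / g`. Cramer's rule as used here combines columns,
-- while the reduction combines rows; the symmetry of `A[ α ] H` bridges the two. Since `det` is
-- given only by expansion along row 0, its further properties rest on one principle: an alternating
-- form in the rows of a square matrix is `det` times its value at the identity. Products, block
-- sums and the reduced root rows are each settled by recognising such a form. The field need not
-- contain roots of a given polynomial, so the spectra of the shifted copies of `H` cannot be
-- assumed to exist. They are carved out of the given list `σ`, each linear factor being assigned to
-- a factor that it divides.

-- Deleting indices.

punchIn-view : ∀ {n} (j i : Fin (suc n)) → i ≡ j ⊎ Σ[ k ∈ Fin n ] i ≡ punchIn j k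
punchIn-view j i with j ≟ i
... | yes j≡i = inj₁ (≡.sym j≡i)
... | no  j≢i = inj₂ (punchOut j≢i , ≡.sym (punchIn-punchOut j≢i))

-- Columns `i` and `j` may be deleted in either order, so the two terms of a double Laplace
-- expansion that use the same pair of columns share their minor.
punchIn-punchIn : ∀ {n} {i j : Fin (suc (suc n))} (i≢j : i ≢ j) (j≢i : j ≢ i) k →
  punchIn i (punchIn (punchOut i≢j) k) ≡ punchIn j (punchIn (punchOut j≢i) k)
punchIn-punchIn {_}     {zero}  {zero}  i≢j j≢i k       = ⊥-elim (i≢j ≡.refl)
punchIn-punchIn {_}     {zero}  {suc j} i≢j j≢i k       = ≡.refl
punchIn-punchIn {_}     {suc i} {zero}  i≢j j≢i k       = ≡.refl
punchIn-punchIn {suc n} {suc i} {suc j} i≢j j≢i zero    = ≡.refl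
punchIn-punchIn {suc n} {suc i} {suc j} i≢j j≢i (suc k) =
  ≡.cong suc (punchIn-punchIn (i≢j ∘ ≡.cong suc) (j≢i ∘ ≡.cong suc) k)

-- Multilinear and alternating forms; the determinant as the unique normalised one.

module Alternation {c ℓ} (S : CommutativeRing c ℓ) where
  open CommutativeRing S hiding (zero)
  open Determinant rawRing
  open RingProperties ring
    using (-0#≈0#; -‿distribˡ-*; -‿distribʳ-*; -‿involutive; -1*x≈-x; +-inverseˡ-unique)
  open SemiringSum semiring
    using (sum; sum-cong-≋; sum-replicate-zero; ∑-distrib-+; *-distribˡ-sum; *-distribʳ-sum)
  open SemiringSolver commutativeSemiring
    using (solve; _:=_; _:+_; _:*_)
  open SetoidReasoning setoid

  sum-zero : ∀ {n} {f : Vector Carrier n} → (∀ i → f i ≈ 0#) → sum f ≈ 0#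
  sum-zero {n} f≈0 = trans (sum-cong-≋ f≈0) (sum-replicate-zero n)

  sum-linear : ∀ {n} a {f g h : Vector Carrier n} →
    (∀ i → f i ≈ a * g i + h i) → sum f ≈ a * sum g + sum h
  sum-linear a {f} {g} {h} eq = begin
    sum f                          ≈⟨ sum-cong-≋ eq ⟩
    sum (λ i → a * g i + h i)      ≈⟨ ∑-distrib-+ (λ i → a * g i) h ⟩
    sum (λ i → a * g i) + sum h    ≈⟨ +-congʳ (*-distribˡ-sum a g) ⟨
    a * sum g + sum h              ∎

  indicator : Bool → Carrier
  indicator b = if b then 1# else 0#

  identity : ∀ {n} → Matrix Carrier n
  identity i j = indicator (does (i ≟ j))

  sum-indicator : ∀ {n} (i : Fin n) (f : Vector Carrier n) →
    sum (λ j → identity i j * f j) ≈ f i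
  sum-indicator zero    f =
    trans (+-cong (*-identityˡ _) (sum-zero λ j → zeroˡ (f (suc j)))) (+-identityʳ _)
  sum-indicator (suc i) f =
    trans (+-cong (zeroˡ _) (sum-indicator i (f ∘ suc))) (+-identityˡ _)

  identity-diagonal : ∀ {n} (i : Fin n) → identity i i ≈ 1#
  identity-diagonal zero    = refl
  identity-diagonal (suc i) = identity-diagonal i

  identity-off : ∀ {n} {i j : Fin n} → i ≢ j → identity i j ≈ 0#
  identity-off {i = i} {j} i≢j with i ≟ j
  ... | yes i≡j = ⊥-elim (i≢j i≡j)
  ... | no  _   = refl

  identity-sym : ∀ {n} (i j : Fin n) → identity i j ≈ identity j i
  identity-sym i j with i ≟ j
  ... | yes ≡.refl = sym (identity-diagonal i)
  ... | no  i≢j    = sym (identity-off (i≢j ∘ ≡.sym))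

  sum-indicatorʳ : ∀ {n} (i : Fin n) (f : Vector Carrier n) →
    sum (λ j → f j * identity j i) ≈ f i
  sum-indicatorʳ i f = trans
    (sum-cong-≋ λ j → trans (*-comm (f j) (identity j i)) (*-congʳ (identity-sym j i)))
    (sum-indicator i f)

  -- The combination is a hypothesis on entries, since entrywise equal vectors are not identical
  -- functions. The choice `a = 0` recovers congruence.
  Linear : ∀ {k} → (Vector Carrier k → Carrier) → Set (c ⊔ ℓ)
  Linear φ = ∀ a {u v w} → (∀ j → u j ≈ a * v j + w j) → φ u ≈ a * φ v + φ w

  module _ {k} {φ : Vector Carrier k → Carrier} (linear : Linear φ) where

    -- A vector with zero entries equals `- 1# * u + u` entrywise, so linearity alone yields
    -- `φ u ≈ - φ u + φ u`.
    linear-zero : ∀ {u} → (∀ j → u j ≈ 0#) → φ u ≈ 0#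
    linear-zero {u} u≈0 = begin
      φ u                    ≈⟨ linear (- 1#) (λ j → begin
        u j                    ≈⟨ u≈0 j ⟩
        0#                     ≈⟨ zeroʳ _ ⟨
        - 1# * 0#              ≈⟨ *-congˡ (u≈0 j) ⟨
        - 1# * u j             ≈⟨ +-identityʳ _ ⟨
        - 1# * u j + 0#        ≈⟨ +-congˡ (u≈0 j) ⟨
        - 1# * u j + u j       ∎) ⟩
      - 1# * φ u + φ u       ≈⟨ +-congʳ (-1*x≈-x (φ u)) ⟩
      - φ u + φ u            ≈⟨ -‿inverseˡ (φ u) ⟩
      0#                     ∎

    linear-sum : ∀ {p} (a : Vector Carrier p) (v : Fin p → Vector Carrier k) {u} →
      (∀ j → u j ≈ sum λ s → a s * v s j) → φ u ≈ sum λ s → a s * φ (v s)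
    linear-sum {zero}  a v eq = linear-zero eq
    linear-sum {suc p} a v eq = trans (linear (a zero) eq)
      (+-congˡ (linear-sum (a ∘ suc) (v ∘ suc) λ j → refl))

    linear-expand : ∀ u → φ u ≈ sum λ s → u s * φ (identity s)
    linear-expand u = linear-sum u identity λ j → sym (sum-indicatorʳ j u)

  Rows : ℕ → ℕ → Set c
  Rows n k = Fin n → Vector Carrier k

  infix 4 _≋_
  _≋_ : ∀ {n k} → Rows n k → Rows n k → Set ℓ
  A ≋ B = ∀ i j → A i j ≈ B i j

  -- Rows and columns are counted separately because fixing a row leaves a form in fewer rows of the
  -- same length. Congruence is a field of its own: with no rows, linearity says nothing.
  record Multilinear {n k} (D : Rows n k → Carrier) : Set (c ⊔ ℓ) where
    field
      congruent : ∀ {A B} → A ≋ B → D A ≈ D B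
      linear    : ∀ i a {A B C} → (∀ j → A i j ≈ a * B i j + C i j) →
                  (∀ k → k ≢ i → ∀ j → A k j ≈ B k j) →
                  (∀ k → k ≢ i → ∀ j → A k j ≈ C k j) →
                  D A ≈ a * D B + D C

  -- Vanishing on a repeated row, rather than a sign change under a swap, is the condition that
  -- stays strong enough when 2 is a zero divisor.
  record Alternating {n k} (D : Rows n k → Carrier) : Set (c ⊔ ℓ) where
    field
      multilinear : Multilinear D
      vanishes    : ∀ {A i j} → i ≢ j → (∀ k → A i k ≈ A j k) → D A ≈ 0#
    open Multilinear multilinear public

  multilinear-fixed : ∀ {n k} {D : Rows (suc n) k → Carrier} → Multilinear D →
    ∀ u → Multilinear (λ N → D (u ◂ N))
  multilinear-fixed ml u = record
    { congruent = λ A≋B → congruent λ { zero j → refl ; (suc i) j → A≋B i j }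
    ; linear    = λ i a eq eqB eqC → linear (suc i) a eq
        (λ { zero _ _ → refl ; (suc k) k≢i → eqB k (k≢i ∘ ≡.cong suc) })
        (λ { zero _ _ → refl ; (suc k) k≢i → eqC k (k≢i ∘ ≡.cong suc) })
    } where open Multilinear ml

  alternating-fixed : ∀ {n k} {D : Rows (suc n) k → Carrier} → Alternating D →
    ∀ u → Alternating (λ N → D (u ◂ N))
  alternating-fixed alt u = record
    { multilinear = multilinear-fixed multilinear u
    ; vanishes    = λ i≢j eq → vanishes (i≢j ∘ suc-injective) eq
    } where open Alternating alt

  module _ {n k} {D : Rows (suc n) k → Carrier} (ml : Multilinear D) where
    open Multilinear ml

    uncons : ∀ A → D A ≈ D (A zero ◂ A ∘ suc)
    uncons A = congruent λ { zero j → refl ; (suc i) j → refl }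

    linear₀ : ∀ N → Linear (λ u → D (u ◂ N))
    linear₀ N a eq = linear zero a eq
      (λ { zero 0≢0 → ⊥-elim (0≢0 ≡.refl) ; (suc _) _ _ → refl })
      (λ { zero 0≢0 → ⊥-elim (0≢0 ≡.refl) ; (suc _) _ _ → refl })

  -- Polarisation: expand `D` at `u + v` in both of the first two rows. Only a repetition in these
  -- two rows is assumed, so the lemma already applies to `det` before `det` is known to be
  -- alternating.
  swap : ∀ {n k} {D : Rows (suc (suc n)) k → Carrier} → Multilinear D →
    (∀ u N → D (u ◂ u ◂ N) ≈ 0#) →
    ∀ u v N → D (u ◂ v ◂ N) ≈ - D (v ◂ u ◂ N)
  swap {D = D} ml eq₀ u v N = +-inverseˡ-unique _ _ (begin
    F u v + F v u                            ≈⟨ +-cong (+-identityˡ _) (+-identityʳ _) ⟨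
    (0# + F u v) + (F v u + 0#)              ≈⟨ +-cong (+-congʳ (eq₀ u N)) (+-congˡ (eq₀ v N)) ⟨
    (F u u + F u v) + (F v u + F v v)        ≈⟨ +-cong (add₂ u) (add₂ v) ⟨
    F u w + F v w                            ≈⟨ +-congʳ (*-identityˡ _) ⟨
    1# * F u w + F v w                       ≈⟨ linear₀ ml (w ◂ N) 1# (λ j → +-congʳ (sym (*-identityˡ _))) ⟨
    F w w                                    ≈⟨ eq₀ w N ⟩
    0#                                       ∎)
    where
    F = λ a b → D (a ◂ b ◂ N)
    w = λ j → u j + v j
    add₂ : ∀ a → F a w ≈ F a u + F a v
    add₂ a = trans
      (linear₀ (multilinear-fixed ml a) N 1# (λ j → +-congʳ (sym (*-identityˡ _))))
      (+-congʳ (*-identityˡ _))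

  det-cong : ∀ {n} (A B : Matrix Carrier n) → A ≋ B → det A ≈ det B
  det-cong {zero}  A B A≋B = refl
  det-cong {suc n} A B A≋B = sum-cong-≋ λ j → *-congˡ {sign (toℕ j)}
    (*-cong (A≋B zero j) (det-cong _ _ λ i k → A≋B (suc i) (punchIn j k)))

  det-linear : ∀ {n} i a {A B C : Matrix Carrier n} →
    (∀ j → A i j ≈ a * B i j + C i j) →
    (∀ k → k ≢ i → ∀ j → A k j ≈ B k j) →
    (∀ k → k ≢ i → ∀ j → A k j ≈ C k j) →
    det A ≈ a * det B + det C
  det-linear {suc n} zero a {A} {B} {C} eq eqB eqC = sum-linear a λ j → begin
      s j * (A zero j * minor A j)
        ≈⟨ *-congˡ (*-congʳ (eq j)) ⟩
      s j * ((a * B zero j + C zero j) * minor A j)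
        ≈⟨ rearranged _ _ _ _ _ ⟩
      a * (s j * (B zero j * minor A j)) + s j * (C zero j * minor A j)
        ≈⟨ +-cong
            (*-congˡ (*-congˡ (*-congˡ (det-cong _ _ λ i k → eqB (suc i) (λ ()) (punchIn j k)))))
            (*-congˡ (*-congˡ (det-cong _ _ λ i k → eqC (suc i) (λ ()) (punchIn j k)))) ⟩
      a * (s j * (B zero j * minor B j)) + s j * (C zero j * minor C j) ∎
    where
    s = λ (j : Fin (suc n)) → sign (toℕ j)
    minor = λ (M : Matrix Carrier (suc n)) j → det (λ i k → M (suc i) (punchIn j k))
    rearranged : ∀ s a b c m → s * ((a * b + c) * m) ≈ a * (s * (b * m)) + s * (c * m)
    rearranged = solve 5 (λ s a b c m → s :* ((a :* b :+ c) :* m) := a :* (s :* (b :* m)) :+ s :* (c :* m)) refl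
  det-linear {suc n} (suc i) a {A} {B} {C} eq eqB eqC = sum-linear a λ j → begin
      s j * (A zero j * minor A j)
        ≈⟨ *-congˡ (*-congˡ (det-linear i a (λ k → eq (punchIn j k))
             (λ k k≢i l → eqB (suc k) (k≢i ∘ suc-injective) (punchIn j l))
             (λ k k≢i l → eqC (suc k) (k≢i ∘ suc-injective) (punchIn j l)))) ⟩
      s j * (A zero j * (a * minor B j + minor C j))
        ≈⟨ rearranged _ _ _ _ _ ⟩
      a * (s j * (A zero j * minor B j)) + s j * (A zero j * minor C j)
        ≈⟨ +-cong (*-congˡ (*-congˡ (*-congʳ (eqB zero (λ ()) j))))
             (*-congˡ (*-congʳ (eqC zero (λ ()) j))) ⟩
      a * (s j * (B zero j * minor B j)) + s j * (C zero j * minor C j) ∎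
    where
    s = λ (j : Fin (suc n)) → sign (toℕ j)
    minor = λ (M : Matrix Carrier (suc n)) j → det (λ i k → M (suc i) (punchIn j k))
    rearranged : ∀ s m a b c → s * (m * (a * b + c)) ≈ a * (s * (m * b)) + s * (m * c)
    rearranged = solve 5 (λ s m a b c → s :* (m :* (a :* b :+ c)) := a :* (s :* (m :* b)) :+ s :* (m :* c)) refl

  det-multilinear : ∀ {n} → Multilinear (det {n})
  det-multilinear = record { congruent = det-cong _ _ ; linear = det-linear }

  -- The entry `G i k` belongs to the ordered pair `(i , punchIn i k)`, and each pair cancels
  -- against its reverse. The induction removes the pairs that involve index zero; comparing the sum
  -- with its negative would only show that its double vanishes.
  cancelling-sum : ∀ {n} (G : Rows (suc n) n) →
    (∀ {i j} (i≢j : i ≢ j) (j≢i : j ≢ i) → G i (punchOut i≢j) + G j (punchOut j≢i) ≈ 0#) →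
    sum (λ i → sum (G i)) ≈ 0#
  cancelling-sum {zero}  G eq = +-identityʳ _
  cancelling-sum {suc n} G eq = begin
    sum (G zero) + sum (λ i → G (suc i) zero + sum (G (suc i) ∘ suc))
      ≈⟨ +-congˡ (∑-distrib-+ (λ i → G (suc i) zero) (λ i → sum (G (suc i) ∘ suc))) ⟩
    sum (G zero) + (sum (λ i → G (suc i) zero) + sum (λ i → sum (G (suc i) ∘ suc)))
      ≈⟨ +-assoc _ _ _ ⟨
    (sum (G zero) + sum (λ i → G (suc i) zero)) + sum (λ i → sum (G (suc i) ∘ suc))
      ≈⟨ +-cong
          (trans (sym (∑-distrib-+ (G zero) (λ i → G (suc i) zero))) (sum-zero λ k → eq {zero} {suc k} (λ ()) (λ ())))
          (cancelling-sum (λ i → G (suc i) ∘ suc) λ i≢j j≢i →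
             eq (i≢j ∘ suc-injective) (j≢i ∘ suc-injective)) ⟩
    0# + 0#
      ≈⟨ +-identityʳ _ ⟩
    0# ∎

  -- Deleting one of two columns lowers the position of the other exactly when the other lies to its
  -- right. This happens in just one of the two orders, so the exponents differ by one.
  sign-antisym : ∀ {n} {i j : Fin (suc n)} (i≢j : i ≢ j) (j≢i : j ≢ i) →
    sign (toℕ i) * sign (toℕ (punchOut i≢j)) ≈ - (sign (toℕ j) * sign (toℕ (punchOut j≢i)))
  sign-antisym {_} {zero} {zero} i≢j _ = ⊥-elim (i≢j ≡.refl)
  sign-antisym {suc n} {zero} {suc j} _ _ = begin
    1# * sign (toℕ j)          ≈⟨ *-comm _ _ ⟩
    sign (toℕ j) * 1#          ≈⟨ -‿involutive _ ⟨
    - - (sign (toℕ j) * 1#)    ≈⟨ -‿cong (-‿distribˡ-* _ _) ⟩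
    - (- sign (toℕ j) * 1#)    ∎
  sign-antisym {suc n} {suc i} {zero} _ _ = begin
    - sign (toℕ i) * 1#        ≈⟨ -‿distribˡ-* _ _ ⟨
    - (sign (toℕ i) * 1#)      ≈⟨ -‿cong (*-comm _ _) ⟩
    - (1# * sign (toℕ i))      ∎
  sign-antisym {suc n} {suc i} {suc j} i≢j j≢i = begin
    - sign (toℕ i) * - sign (toℕ i′)       ≈⟨ negated _ _ ⟩
    sign (toℕ i) * sign (toℕ i′)           ≈⟨ sign-antisym (i≢j ∘ ≡.cong suc) (j≢i ∘ ≡.cong suc) ⟩
    - (sign (toℕ j) * sign (toℕ j′))       ≈⟨ -‿cong (negated _ _) ⟨
    - (- sign (toℕ j) * - sign (toℕ j′))   ∎
    where
    i′ = punchOut (i≢j ∘ ≡.cong suc)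
    j′ = punchOut (j≢i ∘ ≡.cong suc)
    negated : ∀ x y → - x * - y ≈ x * y
    negated x y = begin
      - x * - y      ≈⟨ -‿distribˡ-* _ _ ⟨
      - (x * - y)    ≈⟨ -‿cong (-‿distribʳ-* _ _) ⟨
      - - (x * y)    ≈⟨ -‿involutive _ ⟩
      x * y          ∎

  -- After expanding along both equal rows, the terms for the columns `(i , j)` and `(j , i)` have
  -- the same entries and minor and opposite signs.
  det-equal₀₁ : ∀ {n} (u : Vector Carrier (suc (suc n))) N → det (u ◂ u ◂ N) ≈ 0#
  det-equal₀₁ {n} u N = begin
    sum (λ i → sign (toℕ i) * (u i * sum (λ j → sign (toℕ j) * (u (punchIn i j) * minor i j))))
      ≈⟨ sum-cong-≋ (λ i → trans (sym (*-assoc (sign (toℕ i)) (u i) _))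
           (*-distribˡ-sum (sign (toℕ i) * u i) (λ j → sign (toℕ j) * (u (punchIn i j) * minor i j)))) ⟩
    sum (λ i → sum (G i))
      ≈⟨ cancelling-sum G cancels ⟩
    0# ∎
    where
    minor : Rows (suc (suc n)) (suc n)
    minor i j = det (λ s t → N s (punchIn i (punchIn j t)))
    G : Rows (suc (suc n)) (suc n)
    G i j = sign (toℕ i) * u i * (sign (toℕ j) * (u (punchIn i j) * minor i j))
    gathered : ∀ s x t y m → s * x * (t * (y * m)) ≈ s * t * (x * y * m)
    gathered = solve 5 (λ s x t y m → s :* x :* (t :* (y :* m)) := s :* t :* (x :* y :* m)) refl
    G′ : ∀ {i j} (i≢j : i ≢ j) → G i (punchOut i≢j) ≈
      sign (toℕ i) * sign (toℕ (punchOut i≢j)) * (u i * u j * minor i (punchOut i≢j))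
    G′ {i} i≢j rewrite punchIn-punchOut i≢j = gathered _ _ _ _ _
    cancels : ∀ {i j} (i≢j : i ≢ j) (j≢i : j ≢ i) →
      G i (punchOut i≢j) + G j (punchOut j≢i) ≈ 0#
    cancels {i} {j} i≢j j≢i = begin
      G i (punchOut i≢j) + G j (punchOut j≢i)
        ≈⟨ +-cong (G′ i≢j) (G′ j≢i) ⟩
      sᵢ * (u i * u j * mᵢ) + sⱼ * (u j * u i * mⱼ)
        ≈⟨ +-congʳ (*-cong (sign-antisym i≢j j≢i) (*-cong (*-comm _ _) (det-cong _ _ λ s t →
             reflexive (≡.cong (N s) (punchIn-punchIn i≢j j≢i t))))) ⟩
      - sⱼ * (u j * u i * mⱼ) + sⱼ * (u j * u i * mⱼ)
        ≈⟨ +-congʳ (-‿distribˡ-* _ _) ⟨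
      - (sⱼ * (u j * u i * mⱼ)) + sⱼ * (u j * u i * mⱼ)
        ≈⟨ -‿inverseˡ _ ⟩
      0# ∎
      where
      sᵢ = sign (toℕ i) * sign (toℕ (punchOut i≢j))
      sⱼ = sign (toℕ j) * sign (toℕ (punchOut j≢i))
      mᵢ = minor i (punchOut i≢j)
      mⱼ = minor j (punchOut j≢i)

  minors-vanish : ∀ {n} (A : Matrix Carrier (suc n)) →
    (∀ l → det (λ i k → A (suc i) (punchIn l k)) ≈ 0#) → det A ≈ 0#
  minors-vanish A eq = sum-zero λ l →
    trans (*-congˡ (trans (*-congˡ (eq l)) (zeroʳ (A zero l)))) (zeroʳ (sign (toℕ l)))

  det-vanishes : ∀ {n} (A : Matrix Carrier n) {i j} →
    i ≢ j → (∀ k → A i k ≈ A j k) → det A ≈ 0#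

  -- If the second equal row is not adjacent to row 0, swapping the first two rows moves both equal
  -- rows below row 0. They then occur in every minor of the expansion, and the smaller case
  -- applies.
  det-vanishes₀ : ∀ {n} (A : Matrix Carrier (suc n)) j →
    (∀ k → A zero k ≈ A (suc j) k) → det A ≈ 0#

  det-vanishes A {i = zero}  {zero}  i≢j eq = ⊥-elim (i≢j ≡.refl)
  det-vanishes A {i = zero}  {suc j} i≢j eq = det-vanishes₀ A j eq
  det-vanishes A {i = suc i} {zero}  i≢j eq = det-vanishes₀ A i (sym ∘ eq)
  det-vanishes A {i = suc i} {suc j} i≢j eq = minors-vanish A λ l →
    det-vanishes _ (i≢j ∘ ≡.cong suc) λ k → eq (punchIn l k)

  det-vanishes₀ {suc n} A zero eq = trans
    (det-cong A (A zero ◂ A zero ◂ (λ i → A (suc (suc i)))) λ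
      { zero k → refl ; (suc zero) k → sym (eq k) ; (suc (suc i)) k → refl })
    (det-equal₀₁ (A zero) (λ i → A (suc (suc i))))
  det-vanishes₀ {suc n} A (suc j) eq = begin
    det A                       ≈⟨ det-cong A (A zero ◂ A₁ ◂ N) (λ
                                     { zero k → refl ; (suc zero) k → refl ; (suc (suc i)) k → refl }) ⟩
    det (A zero ◂ A₁ ◂ N)       ≈⟨ swap det-multilinear det-equal₀₁ (A zero) A₁ N ⟩
    - det (A₁ ◂ A zero ◂ N)     ≈⟨ -‿cong (minors-vanish (A₁ ◂ A zero ◂ N) λ l →
                                     det-vanishes (λ i k → (A zero ◂ N) i (punchIn l k)) {zero} {suc j}
                                       (λ ()) λ k → eq (punchIn l k)) ⟩
    - 0#                        ≈⟨ -0#≈0# ⟩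
    0#                          ∎
    where
    A₁ = A (suc zero)
    N  = λ i → A (suc (suc i))

  det-alternating : ∀ {n} → Alternating (det {n})
  det-alternating = record { multilinear = det-multilinear ; vanishes = det-vanishes _ }

  -- Row clearing: splitting each row by linearity leaves a form with a row `v`, which vanishes. In
  -- its application `v` is a row already fixed inside an alternating form.
  clear : ∀ {n k} {D : Rows n k → Carrier} → Multilinear D → ∀ (v : Vector Carrier k) →
    (∀ {N i} → (∀ j → N i j ≈ v j) → D N ≈ 0#) →
    ∀ (a : Vector Carrier n) {N N′} → (∀ i j → N i j ≈ a i * v j + N′ i j) → D N ≈ D N′
  clear {zero}          ml v eq₀ a eq = Multilinear.congruent ml λ ()
  clear {suc n} {D = D} ml v eq₀ a {N} {N′} eq = begin
    D N                                                ≈⟨ uncons ml N ⟩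
    D (N zero ◂ N ∘ suc)                               ≈⟨ linear₀ ml (N ∘ suc) (a zero) (eq zero) ⟩
    a zero * D (v ◂ N ∘ suc) + D (N′ zero ◂ N ∘ suc)   ≈⟨ +-cong
      (trans (*-congˡ (eq₀ {i = zero} λ j → refl)) (zeroʳ _))
      (clear (multilinear-fixed ml (N′ zero)) v (λ {M} {i} e → eq₀ {i = suc i} e) (a ∘ suc) (eq ∘ suc)) ⟩
    0# + D (N′ zero ◂ N′ ∘ suc)                        ≈⟨ +-identityˡ _ ⟩
    D (N′ zero ◂ N′ ∘ suc)                             ≈⟨ uncons ml N′ ⟨
    D N′                                               ∎

  move : ∀ {n k} {D : Rows (suc n) k → Carrier} → Alternating D →
    ∀ j v N → D (v ◂ N) ≈ sign (toℕ j) * D (insertAt N j v)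
  move {D = D} alt zero v N = trans
    (Alternating.congruent alt λ { zero j → refl ; (suc i) j → refl })
    (sym (*-identityˡ _))
  move {suc n} {D = D} alt (suc j) v N = begin
    D (v ◂ N)
      ≈⟨ congruent (λ { zero j → refl ; (suc zero) j → refl ; (suc (suc i)) j → refl }) ⟩
    D (v ◂ N zero ◂ N ∘ suc)
      ≈⟨ swap multilinear (λ u M → vanishes {i = zero} {suc zero} (λ ()) λ k → refl) v (N zero) (N ∘ suc) ⟩
    - D (N zero ◂ v ◂ N ∘ suc)
      ≈⟨ -‿cong (move (alternating-fixed alt (N zero)) j v (N ∘ suc)) ⟩
    - (sign (toℕ j) * D (N zero ◂ insertAt (N ∘ suc) j v))
      ≈⟨ -‿distribˡ-* _ _ ⟩
    - sign (toℕ j) * D (N zero ◂ insertAt (N ∘ suc) j v)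
      ≈⟨ *-congˡ (congruent λ { zero k → refl ; (suc i) k → refl }) ⟩
    - sign (toℕ j) * D (insertAt N (suc j) v) ∎
    where open Alternating alt

  -- T A is a larger matrix: row i of A, sent through L, sits at position e i,
  -- and the remaining rows do not depend on A.
  alternating-embed : ∀ {n k n′ k′} {D : Rows n′ k′ → Carrier} → Alternating D →
    (e : Fin n → Fin n′) → (∀ {i j} → e i ≡ e j → i ≡ j) →
    (L : Vector Carrier k → Vector Carrier k′) →
    (∀ {u v} → (∀ j → u j ≈ v j) → ∀ l → L u l ≈ L v l) →
    (∀ l → Linear (λ v → L v l)) →
    (T : Rows n k → Rows n′ k′) →
    (∀ A i l → T A (e i) l ≈ L (A i) l) →
    (∀ A B p → (∀ i → p ≢ e i) → ∀ l → T A p l ≈ T B p l) →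
    Alternating (λ A → D (T A))
  alternating-embed {n} {k} alt e e-injective L L-cong L-linear T inside outside = record
    { multilinear = record
      { congruent = λ A≋B → congruent λ p → rows p λ i _ → A≋B i
      ; linear    = λ i a eq eqB eqC → linear (e i) a
          (λ l → trans (inside _ i l) (trans (L-linear l a eq)
            (sym (+-cong (*-congˡ (inside _ i l)) (inside _ i l)))))
          (λ p p≢ → rows p λ { i′ ≡.refl → eqB i′ (p≢ ∘ ≡.cong e) })
          (λ p p≢ → rows p λ { i′ ≡.refl → eqC i′ (p≢ ∘ ≡.cong e) })
      }
    ; vanishes    = λ {A} {i} {j} i≢j eq → vanishes (i≢j ∘ e-injective)
        (λ l → trans (inside A i l) (trans (L-cong eq l) (sym (inside A j l))))
    }
    where
    open Alternating alt
    rows : ∀ {A B : Rows n k} p → (∀ i → p ≡ e i → ∀ j → A i j ≈ B i j) →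
      ∀ l → T A p l ≈ T B p l
    rows {A} {B} p eq l with any? (λ i → p ≟ e i)
    ... | yes (i , ≡.refl) =
      trans (inside A i l) (trans (L-cong (eq i ≡.refl) l) (sym (inside B i l)))
    ... | no  p≢           = outside A B p (λ i p≡ → p≢ (i , p≡)) l

  insertAt-cong : ∀ {n} j {x} {v w : Vector Carrier n} → (∀ i → v i ≈ w i) →
    ∀ i → insertAt v j x i ≈ insertAt w j x i
  insertAt-cong j {x} {v} {w} v≈w i with punchIn-view j i
  ... | inj₁ ≡.refl rewrite insertAt-lookup v j x | insertAt-lookup w j x = refl
  ... | inj₂ (k , ≡.refl) rewrite insertAt-punchIn v j x k | insertAt-punchIn w j x k = v≈w k

  -- The opposite of passing to a minor: row and column `j` of the identity are put back, so a form
  -- on larger matrices restricts to one on smaller matrices.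
  border : ∀ {n} → Fin (suc n) → Rows n n → Matrix Carrier (suc n)
  border j N = insertAt (λ i → insertAt (N i) j 0#) j (identity j)

  border-row : ∀ {n} j (N : Rows n n) → border j N j ≡ identity j
  border-row j N = insertAt-lookup _ j (identity j)

  border-punchIn : ∀ {n} j (N : Rows n n) i → border j N (punchIn j i) ≡ insertAt (N i) j 0#
  border-punchIn j N i = insertAt-punchIn _ j (identity j) i

  border-alternating : ∀ {n} {D : Matrix Carrier (suc n) → Carrier} → Alternating D →
    ∀ j → Alternating (λ N → D (border j N))
  border-alternating {n} alt j = alternating-embed alt (punchIn j) (punchIn-injective j _ _)
    (λ v → insertAt v j 0#) (insertAt-cong j) insertAt-linear (border j)
    (λ N i l → reflexive (≡.cong-app (border-punchIn j N i) l)) outside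
    where
    insertAt-linear : ∀ l → Linear (λ v → insertAt v j 0# l)
    insertAt-linear l a {u} {v} {w} eq with punchIn-view j l
    ... | inj₁ ≡.refl
      rewrite insertAt-lookup u j 0# | insertAt-lookup v j 0# | insertAt-lookup w j 0# =
      sym (trans (+-identityʳ _) (zeroʳ a))
    ... | inj₂ (l′ , ≡.refl)
      rewrite insertAt-punchIn u j 0# l′ | insertAt-punchIn v j 0# l′ | insertAt-punchIn w j 0# l′ =
      eq l′
    outside : ∀ A B p → (∀ i → p ≢ punchIn j i) → ∀ l → border j A p l ≈ border j B p l
    outside A B p p≢ l with punchIn-view j p
    ... | inj₁ ≡.refl rewrite border-row j A | border-row j B = refl
    ... | inj₂ (i , p≡) = ⊥-elim (p≢ i p≡)

  identity-punchIn : ∀ {n} j (i k : Fin n) → identity (punchIn j i) (punchIn j k) ≡ identity i k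
  identity-punchIn zero    i       k       = ≡.refl
  identity-punchIn (suc j) zero    zero    = ≡.refl
  identity-punchIn (suc j) zero    (suc k) = ≡.refl
  identity-punchIn (suc j) (suc i) zero    = ≡.refl
  identity-punchIn (suc j) (suc i) (suc k) = identity-punchIn j i k

  border-identity : ∀ {n} (j : Fin (suc n)) → border j identity ≋ identity
  border-identity j k l with punchIn-view j k
  ... | inj₁ ≡.refl rewrite border-row j identity = refl
  ... | inj₂ (i , ≡.refl) rewrite border-punchIn j identity i with punchIn-view j l
  ...   | inj₁ ≡.refl rewrite insertAt-lookup (identity i) j 0# =
    sym (identity-off (punchInᵢ≢i j i))
  ...   | inj₂ (m , ≡.refl) rewrite insertAt-punchIn (identity i) j 0# m =
    sym (reflexive (identity-punchIn j i m))

  -- Expanding row 0 in unit vectors reduces to a first row `identity j`. Column `j` of the other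
  -- rows can then be cleared, and what remains is an alternating form of one size less, evaluated
  -- at the minor. The sum obtained is the Laplace expansion.
  alternating-unique : ∀ {n} {D : Matrix Carrier n → Carrier} → Alternating D →
    ∀ A → D A ≈ det A * D identity
  alternating-unique {zero}          alt A =
    trans (Alternating.congruent alt λ ()) (sym (*-identityˡ _))
  alternating-unique {suc n} {D = D} alt A = begin
    D A
      ≈⟨ uncons multilinear A ⟩
    D (A zero ◂ N)
      ≈⟨ linear-expand (linear₀ multilinear N) (A zero) ⟩
    sum (λ j → A zero j * D (identity j ◂ N))
      ≈⟨ sum-cong-≋ (λ j → trans (*-congˡ (term j)) (reorder (A zero j) (sign (toℕ j)) (minor j) (D identity))) ⟩
    sum (λ j → (sign (toℕ j) * (A zero j * minor j)) * D identity)
      ≈⟨ *-distribʳ-sum (D identity) (λ j → sign (toℕ j) * (A zero j * minor j)) ⟨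
    det A * D identity ∎
    where
    open Alternating alt
    N = A ∘ suc
    minor = λ j → det (λ i k → N i (punchIn j k))
    reorder : ∀ a s m d → a * (s * (m * d)) ≈ (s * (a * m)) * d
    reorder = solve 4 (λ a s m d → a :* (s :* (m :* d)) := (s :* (a :* m)) :* d) refl
    N⁰ : Fin (suc n) → Rows n (suc n)
    N⁰ j i = insertAt (λ k → N i (punchIn j k)) j 0#
    decompose : ∀ j i l → N i l ≈ N i j * identity j l + N⁰ j i l
    decompose j i l with punchIn-view j l
    ... | inj₁ ≡.refl rewrite insertAt-lookup (λ k → N i (punchIn j k)) j 0# =
      sym (trans (+-identityʳ _) (trans (*-congˡ (identity-diagonal j)) (*-identityʳ _)))
    ... | inj₂ (k , ≡.refl) rewrite insertAt-punchIn (λ k → N i (punchIn j k)) j 0# k =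
      sym (trans (+-congʳ (trans (*-congˡ (identity-off (punchInᵢ≢i j k ∘ ≡.sym))) (zeroʳ _))) (+-identityˡ _))
    term : ∀ j → D (identity j ◂ N) ≈ sign (toℕ j) * (minor j * D identity)
    term j = begin
      D (identity j ◂ N)
        ≈⟨ clear (multilinear-fixed multilinear (identity j)) (identity j)
             (λ {M} {i} eq → vanishes {i = zero} {suc i} (λ ()) (sym ∘ eq))
             (λ i → N i j) (decompose j) ⟩
      D (identity j ◂ N⁰ j)
        -- Moving the unit row to position `j` produces the Laplace sign, and the resulting matrix
        -- is `border j` of the minor by definition.
        ≈⟨ move alt j (identity j) (N⁰ j) ⟩
      sign (toℕ j) * D (border j (λ i k → N i (punchIn j k)))
        ≈⟨ *-congˡ (alternating-unique (border-alternating alt j) _) ⟩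
      sign (toℕ j) * (minor j * D (border j identity))
        ≈⟨ *-congˡ (*-congˡ (congruent (border-identity j))) ⟩
      sign (toℕ j) * (minor j * D identity) ∎

-- Products, block matrices and the determinant of I ⊗ P + C ⊗ E.

module Blocks {c ℓ} (S : CommutativeRing c ℓ) where
  open CommutativeRing S hiding (zero)
  open Determinant rawRing
  open Alternation S
  open SemiringSum semiring
    using (sum; sum-cong-≋; *-distribˡ-sum)
  open SemiringExp semiring using (_^_; ^-congˡ)
  open SemiringSolver commutativeSemiring
    using (solve; _:=_; _:+_; _:*_)
  open SetoidReasoning setoid

  _⊡_ : ∀ {n k l} → Rows n k → Rows k l → Rows n l
  (A ⊡ B) i j = sum λ k → A i k * B k j

  det-identity₀ : ∀ {n} (A : Matrix Carrier (suc n)) → (∀ j → A zero j ≈ identity zero j) →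
    det A ≈ det (λ i k → A (suc i) (suc k))
  det-identity₀ A eq = trans
    (+-cong
      (trans (*-identityˡ _) (trans (*-congʳ (eq zero)) (*-identityˡ _)))
      (sum-zero λ j → trans (*-congˡ (trans (*-congʳ (eq (suc j))) (zeroˡ _))) (zeroʳ (sign (toℕ (suc j))))))
    (+-identityʳ _)

  det-identity : ∀ n → det (identity {n}) ≈ 1#
  det-identity zero    = refl
  det-identity (suc n) = trans (det-identity₀ (identity {suc n}) λ j → refl) (det-identity n)

  -- For fixed `B`, each row of `A ⊡ B` is a linear function of the same row of `A`, so the left
  -- side is alternating in `A`; at the identity it is `det B`.
  det-⊡ : ∀ {n} (A B : Matrix Carrier n) → det (A ⊡ B) ≈ det A * det B
  det-⊡ A B = trans (alternating-unique alternating A) (*-congˡ (det-cong _ _ λ i → sum-indicator i ∘ (λ j k → B k j)))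
    where
    alternating : Alternating (λ A → det (A ⊡ B))
    alternating = alternating-embed det-alternating (λ i → i) (λ i≡j → i≡j)
      (λ v j → sum λ k → v k * B k j)
      (λ u≈v j → sum-cong-≋ λ k → *-congʳ (u≈v k))
      (λ j a {u} {v} {w} eq → sum-linear a λ k → trans (*-congʳ (eq k))
        (trans (distribʳ (B k j) (a * v k) (w k)) (+-congʳ (*-assoc a (v k) (B k j)))))
      (λ A → A ⊡ B) (λ A i j → refl) (λ A B p p≢ → ⊥-elim (p≢ p ≡.refl))

  blockEntry : ∀ {n k} → Matrix Carrier n → Matrix Carrier k → Fin n ⊎ Fin k → Fin n ⊎ Fin k → Carrier
  blockEntry A B (inj₁ i) (inj₁ j) = A i j
  blockEntry A B (inj₁ i) (inj₂ j) = 0#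
  blockEntry A B (inj₂ i) (inj₁ j) = 0#
  blockEntry A B (inj₂ i) (inj₂ j) = B i j

  _⊕_ : ∀ {n k} → Matrix Carrier n → Matrix Carrier k → Matrix Carrier (n +ℕ k)
  _⊕_ {n} A B p q = blockEntry A B (splitAt n p) (splitAt n q)

  det-identity-⊕ : ∀ n {k} (B : Matrix Carrier k) → det (identity {n} ⊕ B) ≈ det B
  det-identity-⊕ zero    B = refl
  det-identity-⊕ (suc n) B = trans (det-identity₀ (identity {suc n} ⊕ B) row₀)
    (trans (det-cong _ _ rest) (det-identity-⊕ n B))
    where
    row₀ : ∀ q → (identity {suc n} ⊕ B) zero q ≈ identity zero q
    row₀ zero = refl
    row₀ (suc q) with splitAt n q
    ... | inj₁ _ = refl
    ... | inj₂ _ = refl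
    rest : ∀ p q → (identity {suc n} ⊕ B) (suc p) (suc q) ≈ (identity {n} ⊕ B) p q
    rest p q with splitAt n p | splitAt n q
    ... | inj₁ _ | inj₁ _ = refl
    ... | inj₁ _ | inj₂ _ = refl
    ... | inj₂ _ | inj₁ _ = refl
    ... | inj₂ _ | inj₂ _ = refl

  -- Only the rows of `A` are varied. At `A = identity` the unit rows are stripped one by one until
  -- `B` is left.
  det-⊕ : ∀ {n k} (A : Matrix Carrier n) (B : Matrix Carrier k) → det (A ⊕ B) ≈ det A * det B
  det-⊕ {n} {k} A B = trans (alternating-unique alternating A) (*-congˡ (det-identity-⊕ n B))
    where
    extend : Vector Carrier n → Vector Carrier (n +ℕ k)
    extend v q = [ v , const 0# ]′ (splitAt n q)
    extend-cong : ∀ {u v} → (∀ j → u j ≈ v j) → ∀ q → extend u q ≈ extend v q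
    extend-cong u≈v q with splitAt n q
    ... | inj₁ j = u≈v j
    ... | inj₂ _ = refl
    extend-linear : ∀ q → Linear (λ v → extend v q)
    extend-linear q a eq with splitAt n q
    ... | inj₁ j = eq j
    ... | inj₂ _ = sym (trans (+-identityʳ _) (zeroʳ a))
    inside : ∀ A i q → (A ⊕ B) (i ↑ˡ k) q ≈ extend (A i) q
    inside A i q rewrite splitAt-↑ˡ n i k with splitAt n q
    ... | inj₁ _ = refl
    ... | inj₂ _ = refl
    outside : ∀ A A′ p → (∀ i → p ≢ i ↑ˡ k) → ∀ q → (A ⊕ B) p q ≈ (A′ ⊕ B) p q
    outside A A′ p p≢ q with splitAt n p in eq
    ... | inj₁ i = ⊥-elim (p≢ i (≡.sym (splitAt⁻¹-↑ˡ eq)))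
    ... | inj₂ _ with splitAt n q
    ...   | inj₁ _ = refl
    ...   | inj₂ _ = refl
    alternating : Alternating (λ A → det (A ⊕ B))
    alternating = alternating-embed det-alternating (_↑ˡ k) (↑ˡ-injective k _ _)
      extend extend-cong extend-linear (_⊕ B) inside outside

  Pairs : ℕ → ℕ → Set
  Pairs r n = Fin r × Fin n

  flatten : ∀ {r n} → (Pairs r n → Pairs r n → Carrier) → Matrix Carrier (r *ℕ n)
  flatten {r} {n} G p q = G (remQuot {r} n p) (remQuot {r} n q)

  identity-flatten : ∀ {r n} (p q : Fin (r *ℕ n)) →
    let (i , h) = remQuot {r} n p
        (j , k) = remQuot {r} n q
    in identity p q ≈ identity i j * identity h k
  identity-flatten {r} {n} p q with p ≟ q
  ... | yes ≡.refl = sym (trans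
    (*-cong (identity-diagonal (proj₁ (remQuot {r} n p))) (identity-diagonal (proj₂ (remQuot {r} n p))))
    (*-identityˡ 1#))
  ... | no  p≢q with proj₁ (remQuot {r} n p) ≟ proj₁ (remQuot {r} n q)
  ...   | no  _   = sym (zeroˡ _)
  ...   | yes i≡j = sym (trans (*-identityˡ _) (identity-off λ h≡k → p≢q
    (≡.trans (≡.sym (combine-remQuot {r} n p)) (≡.trans (≡.cong₂ combine i≡j h≡k) (combine-remQuot {r} n q)))))

  -- The Kronecker product I ⊗ A.
  copies : ∀ {r n} → Matrix Carrier n → Pairs r n → Pairs r n → Carrier
  copies A (i , h) (j , k) = identity i j * A h k

  det-copies : ∀ r {n} (A : Matrix Carrier n) → det (flatten (copies {r} A)) ≈ det A ^ r
  det-copies zero        A = refl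
  det-copies (suc r) {n} A = begin
    det (flatten (copies {suc r} A))       ≈⟨ det-cong _ _ first ⟩
    det (A ⊕ flatten (copies {r} A))       ≈⟨ det-⊕ A (flatten (copies {r} A)) ⟩
    det A * det (flatten (copies {r} A))   ≈⟨ *-congˡ (det-copies r A) ⟩
    det A * det A ^ r                      ∎
    where
    first : flatten (copies {suc r} A) ≋ (A ⊕ flatten (copies {r} A))
    first p q with splitAt n p | splitAt n q
    ... | inj₁ h | inj₁ k = *-identityˡ _
    ... | inj₁ h | inj₂ _ = zeroˡ _
    ... | inj₂ _ | inj₁ k = zeroˡ _
    ... | inj₂ p | inj₂ q = refl

  sum-↑ : ∀ n {k} (f : Vector Carrier (n +ℕ k)) →
    sum f ≈ sum (λ i → f (i ↑ˡ k)) + sum (λ i → f (n ↑ʳ i))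
  sum-↑ zero    f = sym (+-identityˡ _)
  sum-↑ (suc n) f = trans (+-congˡ (sum-↑ n (f ∘ suc))) (sym (+-assoc _ _ _))

  sum-remQuot : ∀ {r n} (f : Pairs r n → Carrier) →
    sum (λ p → f (remQuot {r} n p)) ≈ sum λ i → sum λ h → f (i , h)
  sum-remQuot {zero}      f = refl
  sum-remQuot {suc r} {n} f = begin
    sum (λ p → f (remQuot {suc r} n p))
      ≈⟨ sum-↑ n (λ p → f (remQuot {suc r} n p)) ⟩
    sum (λ h → f (remQuot {suc r} n (h ↑ˡ r *ℕ n))) + sum (λ p → f (remQuot {suc r} n (n ↑ʳ p)))
      ≈⟨ +-cong
          (sum-cong-≋ λ h → reflexive (≡.cong f (remQuot-combine {suc r} zero h)))
          (sum-cong-≋ λ p → reflexive (≡.cong (f ∘ shift) (splitAt-↑ʳ n (r *ℕ n) p))) ⟩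
    sum (λ h → f (zero , h)) + sum (λ p → f (shift (inj₂ p)))
      ≈⟨ +-congˡ (sum-remQuot {r} {n} (λ (i , h) → f (suc i , h))) ⟩
    sum (λ i → sum λ h → f (i , h)) ∎
    where
    -- This is `remQuot` with its call of `splitAt` abstracted, so that an equation for `splitAt`
    -- can be applied under it.
    shift : Fin n ⊎ Fin (r *ℕ n) → Pairs (suc r) n
    shift x = let (h , i) = [ (λ h → h , zero) , (λ p → map₂ suc (quotRem {r} n p)) ]′ x in i , h

  infixl 8 _[_]≔_
  _[_]≔_ : ∀ {n k} → Rows n k → Fin n → Vector Carrier k → Rows n k
  A [ i ]≔ v = updateAt A i (const v)

  ≔-updated : ∀ {n k} (A : Rows n k) i v → (A [ i ]≔ v) i ≡ v
  ≔-updated A i v = updateAt-updates i A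

  ≔-other : ∀ {n k} (A : Rows n k) {i} v {j} → j ≢ i → (A [ i ]≔ v) j ≡ A j
  ≔-other A {i} v {j} j≢i = updateAt-minimal j i A j≢i

  det-≔-linear : ∀ {n} (A : Matrix Carrier n) i → Linear (λ v → det (A [ i ]≔ v))
  det-≔-linear A i a {u} {v} {w} eq = det-linear i a row (others v) (others w)
    where
    row : ∀ j → (A [ i ]≔ u) i j ≈ a * (A [ i ]≔ v) i j + (A [ i ]≔ w) i j
    row j rewrite ≔-updated A i u | ≔-updated A i v | ≔-updated A i w = eq j
    others : ∀ v k → k ≢ i → ∀ j → (A [ i ]≔ u) k j ≈ (A [ i ]≔ v) k j
    others v k k≢i j rewrite ≔-other A u k≢i | ≔-other A v k≢i = refl

  -- The adjugate relation in row form: for `k` different from `i` the row `A k` occurs twice.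
  det-≔-row : ∀ {n} (A : Matrix Carrier n) i k →
    det (A [ i ]≔ A k) ≈ identity i k * det A
  det-≔-row A i k with i ≟ k
  ... | yes ≡.refl = trans (det-cong _ _ same) (sym (*-identityˡ _))
    where
    same : (A [ i ]≔ A i) ≋ A
    same j l with j ≟ i
    ... | yes ≡.refl rewrite ≔-updated A i (A i)     = refl
    ... | no  j≢i    rewrite ≔-other A (A i) j≢i     = refl
  ... | no i≢k = trans (det-vanishes _ i≢k equal) (sym (zeroˡ _))
    where
    equal : ∀ l → (A [ i ]≔ A k) i l ≈ (A [ i ]≔ A k) k l
    equal l rewrite ≔-updated A i (A k) | ≔-other A (A k) (i≢k ∘ ≡.sym) = refl

  module _ {m : ℕ} where

    private
      n = suc m
      ε : Vector Carrier n
      ε = identity root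

    -- This is I ⊗ P + C ⊗ E. Writing `E` as the product `ε h * ε k` separates its row index from
    -- its column index, so sums over either one collapse.
    rooted : ∀ {r} → Matrix Carrier n → Matrix Carrier r → Pairs r n → Pairs r n → Carrier
    rooted P C (i , h) (j , k) = identity i j * P h k + C i j * (ε h * ε k)

    module _ (P : Matrix Carrier n) (P-sym : ∀ h k → P h k ≈ P k h) where

      private
        -- The cofactors of the root row of `P`, that is, the root column of its adjugate. They
        -- exist whether or not `P` is invertible.
        q : Vector Carrier n
        q h = det (P [ root ]≔ identity h)

        f g : Carrier
        f = det P
        g = det (P [ root ]≔ ε)

        Q : Matrix Carrier n
        Q = identity [ root ]≔ q

      -- Cramer's rule for the row q; symmetry lets it act from the left.
      q-P : ∀ k → sum (λ h → q h * P h k) ≈ ε k * f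
      q-P k = begin
        sum (λ h → q h * P h k)   ≈⟨ sum-cong-≋ (λ h → trans (*-comm (q h) (P h k)) (*-congʳ (P-sym h k))) ⟩
        sum (λ h → P k h * q h)   ≈⟨ linear-expand (det-≔-linear P root) (P k) ⟨
        det (P [ root ]≔ P k)     ≈⟨ det-≔-row P root k ⟩
        ε k * f                   ∎

      -- `Q` differs from the identity only in the root row, so only the root entry of `q`
      -- contributes.
      det-Q : det Q ≈ g
      det-Q = begin
        det (identity [ root ]≔ q)
          ≈⟨ linear-expand (det-≔-linear identity root) q ⟩
        sum (λ h → q h * det (identity [ root ]≔ identity h))
          ≈⟨ sum-cong-≋ (λ h → trans (*-congˡ (trans (det-≔-row identity root h)
               (trans (*-congˡ (det-identity n)) (*-identityʳ (ε h))))) (*-comm (q h) (ε h))) ⟩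
        sum (λ h → ε h * q h)
          ≈⟨ sum-indicator root q ⟩
        g ∎

      -- The shape after the row combination: `C` occurs only in the root rows, one row of `C` in
      -- each, which makes the determinant an alternating form in `C`.
      rootRows : ∀ {r} → Matrix Carrier r → Pairs r n → Pairs r n → Carrier
      rootRows C (i , h) (j , k) = if does (h ≟ root) then C i j * ε k else identity i j * P h k

      -- At `C = identity` the matrix falls apart into `r` copies of `P [ root ]≔ ε`, each of
      -- determinant `g`; the alternating form is therefore `det C` times this value.
      det-rootRows : ∀ {r} (C : Matrix Carrier r) → det (flatten (rootRows C)) ≈ det C * g ^ r
      det-rootRows {r} C = begin
        det (flatten (rootRows C))
          ≈⟨ alternating-unique alternating C ⟩
        det C * det (flatten (rootRows {r} identity))
          ≈⟨ *-congˡ (trans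
               (det-cong (flatten (rootRows {r} identity)) (flatten (copies {r} (P [ root ]≔ ε)))
                 λ p q → block (remQuot {r} n p) (remQuot {r} n q))
               (det-copies r (P [ root ]≔ ε))) ⟩
        det C * g ^ r ∎
        where
        block : ∀ x y → rootRows identity x y ≈ copies (P [ root ]≔ ε) x y
        block (i , h) (j , k) with h ≟ root
        ... | yes ≡.refl rewrite ≔-updated P root ε = refl
        ... | no  h≢root rewrite ≔-other P ε h≢root = refl
        alternating : Alternating (λ C → det (flatten (rootRows {r} C)))
        alternating = alternating-embed det-alternating
          (λ i → combine i root) (λ {i} {j} eq → combine-injectiveˡ i root j root eq)
          (λ v p → let (j , k) = remQuot {r} n p in v j * ε k)
          (λ u≈v p → *-congʳ (u≈v _))
          (λ p a {u} {v} {w} eq → trans (*-congʳ (eq _)) (trans (distribʳ _ _ _) (+-congʳ (*-assoc a _ _))))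
          (λ C → flatten (rootRows C)) inside outside
          where
          inside : ∀ C i p → flatten (rootRows {r} C) (combine i root) p
            ≈ (let (j , k) = remQuot {r} n p in C i j * ε k)
          inside C i p = trans
            (reflexive (≡.cong (λ x → rootRows C x (remQuot {r} n p)) (remQuot-combine {r} i root)))
            (at-root (remQuot {r} n p))
            where
            at-root : ∀ y → rootRows C (i , root) y ≈ C i (proj₁ y) * ε (proj₂ y)
            at-root y with root {m} ≟ root
            ... | yes _  = refl
            ... | no ¬eq = ⊥-elim (¬eq ≡.refl)
          off-root : ∀ A B x → proj₂ x ≢ root → ∀ y → rootRows {r} A x y ≈ rootRows {r} B x y
          off-root A B (i , h) h≢root y with h ≟ root
          ... | yes h≡root = ⊥-elim (h≢root h≡root)
          ... | no  _      = refl
          outside : ∀ A B p → (∀ i → p ≢ combine i root) → ∀ q →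
            flatten (rootRows {r} A) p q ≈ flatten (rootRows {r} B) p q
          outside A B p p≢ q = off-root A B (remQuot {r} n p)
            (λ h≡root → p≢ (proj₁ (remQuot {r} n p))
              (≡.trans (≡.sym (combine-remQuot {r} n p)) (≡.cong (combine (proj₁ (remQuot {r} n p))) h≡root)))
            (remQuot {r} n q)

      copies-rooted : ∀ {r} (C : Matrix Carrier r) x y →
        sum (λ i → sum λ h → copies Q x (i , h) * rooted P C (i , h) y) ≈
        rootRows (λ i j → f * identity i j + g * C i j) x y
      copies-rooted C (i , h) (j , k) = begin
        sum (λ i′ → sum λ h′ → identity i i′ * Q h h′ * rooted P C (i′ , h′) (j , k))
          ≈⟨ sum-cong-≋ (λ i′ → trans (sum-cong-≋ λ h′ → *-assoc (identity i i′) (Q h h′) (rooted P C (i′ , h′) (j , k)))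
               (sym (*-distribˡ-sum (identity i i′) (λ h′ → Q h h′ * rooted P C (i′ , h′) (j , k))))) ⟩
        sum (λ i′ → identity i i′ * sum λ h′ → Q h h′ * rooted P C (i′ , h′) (j , k))
          ≈⟨ sum-indicator i (λ i′ → sum λ h′ → Q h h′ * rooted P C (i′ , h′) (j , k)) ⟩
        sum (λ h′ → Q h h′ * (identity i j * P h′ k + C i j * (ε h′ * ε k)))
          ≈⟨ row ⟩
        rootRows (λ i j → f * identity i j + g * C i j) (i , h) (j , k) ∎
        where
        row : sum (λ h′ → Q h h′ * (identity i j * P h′ k + C i j * (ε h′ * ε k))) ≈
          rootRows (λ i j → f * identity i j + g * C i j) (i , h) (j , k)
        row with h ≟ root
        ... | no h≢root rewrite ≔-other identity q h≢root = begin
          sum (λ h′ → identity h h′ * (identity i j * P h′ k + C i j * (ε h′ * ε k)))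
            ≈⟨ sum-indicator h (λ h′ → identity i j * P h′ k + C i j * (ε h′ * ε k)) ⟩
          identity i j * P h k + C i j * (ε h * ε k)
            ≈⟨ +-congˡ (trans (*-congˡ (trans (*-congʳ (identity-off (h≢root ∘ ≡.sym))) (zeroˡ _))) (zeroʳ _)) ⟩
          identity i j * P h k + 0#
            ≈⟨ +-identityʳ _ ⟩
          identity i j * P h k ∎
        ... | yes ≡.refl rewrite ≔-updated identity root q = begin
          sum (λ h′ → q h′ * (identity i j * P h′ k + C i j * (ε h′ * ε k)))
            ≈⟨ sum-linear (identity i j) (λ h′ → split (q h′) (identity i j) (P h′ k) (C i j) (ε h′) (ε k)) ⟩
          identity i j * sum (λ h′ → q h′ * P h′ k) + sum (λ h′ → ε h′ * (q h′ * (C i j * ε k)))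
            -- The second sum picks out `q root`, which is `g` by definition.
            ≈⟨ +-cong (*-congˡ (q-P k)) (sum-indicator root (λ h′ → q h′ * (C i j * ε k))) ⟩
          identity i j * (ε k * f) + g * (C i j * ε k)
            ≈⟨ collect (identity i j) (ε k) f g (C i j) ⟩
          (f * identity i j + g * C i j) * ε k ∎
          where
          split : ∀ q d p c e e′ → q * (d * p + c * (e * e′)) ≈ d * (q * p) + e * (q * (c * e′))
          split = solve 6 (λ q d p c e e′ →
            q :* (d :* p :+ c :* (e :* e′)) := d :* (q :* p) :+ e :* (q :* (c :* e′))) refl
          collect : ∀ d e f g c → d * (e * f) + g * (c * e) ≈ (f * d + g * c) * e
          collect = solve 5 (λ d e f g c → d :* (e :* f) :+ g :* (c :* e) := (f :* d :+ g :* c) :* e) refl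

      -- The left factor is the determinant of I ⊗ Q, the right one that of the reduced root rows.
      -- Over an arbitrary commutative ring they cannot be cancelled; this waits for the polynomial
      -- ring, where `g` is monic.
      det-rooted : ∀ {r} (C : Matrix Carrier r) →
        g ^ r * det (flatten (rooted P C)) ≈ g ^ r * det (λ i j → f * identity i j + g * C i j)
      det-rooted {r} C = begin
        g ^ r * det (flatten (rooted P C))
          ≈⟨ *-congʳ (trans (det-copies r Q) (^-congˡ r det-Q)) ⟨
        det (flatten (copies {r} Q)) * det (flatten (rooted P C))
          ≈⟨ det-⊡ (flatten (copies {r} Q)) (flatten (rooted P C)) ⟨
        det (flatten (copies {r} Q) ⊡ flatten (rooted P C))
          ≈⟨ det-cong (flatten (copies {r} Q) ⊡ flatten (rooted P C)) (flatten (rootRows C′)) (λ p p′ → trans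
               (sum-remQuot {r} (λ x → copies Q (remQuot {r} n p) x * rooted P C x (remQuot {r} n p′)))
               (copies-rooted C (remQuot {r} n p) (remQuot {r} n p′))) ⟩
        det (flatten (rootRows C′))
          ≈⟨ det-rootRows C′ ⟩
        det C′ * g ^ r
          ≈⟨ *-comm (det C′) (g ^ r) ⟩
        g ^ r * det C′ ∎
        where C′ = λ i j → f * identity i j + g * C i j

    -- The added term is zero outside the root row and there equals `c` times `ε`, so linearity in
    -- that single row suffices.
    det-root-shift : ∀ (P : Matrix Carrier n) c →
      det (λ h k → P h k + c * (ε h * ε k)) ≈ c * det (P [ root ]≔ ε) + det P
    det-root-shift P c = det-linear root c row others others′
      where
      row : ∀ k → P root k + c * (ε root * ε k) ≈ c * (P [ root ]≔ ε) root k + P root k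
      row k rewrite ≔-updated P root ε = trans (+-comm _ _)
        (+-congʳ (*-congˡ (trans (*-congʳ (identity-diagonal (root {m}))) (*-identityˡ _))))
      others′ : ∀ h → h ≢ root → ∀ k → P h k + c * (ε h * ε k) ≈ P h k
      others′ h h≢root k = trans (+-congˡ (trans (*-congˡ (trans
        (*-congʳ (identity-off (h≢root ∘ ≡.sym))) (zeroˡ _))) (zeroʳ _))) (+-identityʳ _)
      others : ∀ h → h ≢ root → ∀ k → P h k + c * (ε h * ε k) ≈ (P [ root ]≔ ε) h k
      others h h≢root k rewrite ≔-other P ε h≢root = others′ h h≢root k

-- The ring of polynomials, degree bounds and monic polynomials.

module PolynomialRing {c ℓ} (K : CommutativeRing c ℓ) where
  open CommutativeRing K hiding (zero)
  open Polynomial K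
  open RingProperties ring using (-0#≈0#)
  open SemiringSolver commutativeSemiring
    using (solve; _:=_; _:+_; _:*_)
  open SetoidReasoning setoid

  Sequence : Set c
  Sequence = ℕ → Carrier

  infix 4 _≗_
  _≗_ : Sequence → Sequence → Set ℓ
  f ≗ g = ∀ k → f k ≈ g k

  infixl 7 _✶_
  -- The Cauchy product of coefficient sequences. Sequences carry no trailing zeros, so the ring
  -- laws are proved here and transferred to lists by `coeff-*`.
  _✶_ : Sequence → Sequence → Sequence
  (f ✶ g) zero    = f zero * g zero
  (f ✶ g) (suc k) = f zero * g (suc k) + ((f ∘ suc) ✶ g) k

  ✶-cong : ∀ {f f′ g g′} → f ≗ f′ → g ≗ g′ → f ✶ g ≗ f′ ✶ g′
  ✶-cong f≗ g≗ zero    = *-cong (f≗ zero) (g≗ zero)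
  ✶-cong f≗ g≗ (suc k) = +-cong (*-cong (f≗ zero) (g≗ (suc k))) (✶-cong (f≗ ∘ suc) g≗ k)

  ✶-zeroˡ : ∀ {f} g → (∀ k → f k ≈ 0#) → ∀ k → (f ✶ g) k ≈ 0#
  ✶-zeroˡ g f≈0 zero    = trans (*-congʳ (f≈0 zero)) (zeroˡ _)
  ✶-zeroˡ g f≈0 (suc k) = trans
    (+-cong (trans (*-congʳ (f≈0 zero)) (zeroˡ _)) (✶-zeroˡ g (f≈0 ∘ suc) k)) (+-identityʳ _)

  ✶-distribʳ : ∀ f g h → (λ k → f k + g k) ✶ h ≗ (λ k → (f ✶ h) k + (g ✶ h) k)
  ✶-distribʳ f g h zero    = distribʳ _ _ _
  ✶-distribʳ f g h (suc k) = trans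
    (+-cong (distribʳ (h (suc k)) (f zero) (g zero)) (✶-distribʳ (f ∘ suc) (g ∘ suc) h k))
    (solve 4 (λ x y z w → (x :+ y) :+ (z :+ w) := (x :+ z) :+ (y :+ w)) refl _ _ _ _)

  ✶-scaleˡ : ∀ a f g → (λ k → a * f k) ✶ g ≗ (λ k → a * (f ✶ g) k)
  ✶-scaleˡ a f g zero    = *-assoc _ _ _
  ✶-scaleˡ a f g (suc k) = trans
    (+-cong (*-assoc a (f zero) (g (suc k))) (✶-scaleˡ a (f ∘ suc) g k)) (sym (distribˡ _ _ _))

  -- The defining recursion peels off the term with `f zero`; this peels off the term at the other
  -- end, which commutativity needs.
  ✶-sucʳ : ∀ f g k → (f ✶ g) (suc k) ≈ (f ✶ (g ∘ suc)) k + f (suc k) * g zero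
  ✶-sucʳ f g zero    = refl
  ✶-sucʳ f g (suc k) = trans (+-congˡ (✶-sucʳ (f ∘ suc) g k)) (sym (+-assoc _ _ _))

  ✶-comm : ∀ f g → f ✶ g ≗ g ✶ f
  ✶-comm f g zero    = *-comm _ _
  ✶-comm f g (suc k) = begin
    f zero * g (suc k) + ((f ∘ suc) ✶ g) k   ≈⟨ +-cong (*-comm _ _) (✶-comm (f ∘ suc) g k) ⟩
    g (suc k) * f zero + (g ✶ (f ∘ suc)) k   ≈⟨ +-comm _ _ ⟩
    (g ✶ (f ∘ suc)) k + g (suc k) * f zero   ≈⟨ ✶-sucʳ g f k ⟨
    (g ✶ f) (suc k)                          ∎

  ✶-assoc : ∀ f g h → (f ✶ g) ✶ h ≗ f ✶ (g ✶ h)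
  ✶-assoc f g h zero    = *-assoc _ _ _
  ✶-assoc f g h (suc k) = begin
    f₀ * g zero * h (suc k) + ((λ j → f₀ * g (suc j) + (f′ ✶ g) j) ✶ h) k
      ≈⟨ +-congˡ (✶-distribʳ (λ j → f₀ * g (suc j)) (f′ ✶ g) h k) ⟩
    f₀ * g zero * h (suc k) + (((λ j → f₀ * g (suc j)) ✶ h) k + ((f′ ✶ g) ✶ h) k)
      ≈⟨ +-congˡ (+-cong (✶-scaleˡ f₀ (g ∘ suc) h k) (✶-assoc f′ g h k)) ⟩
    f₀ * g zero * h (suc k) + (f₀ * ((g ∘ suc) ✶ h) k + (f′ ✶ (g ✶ h)) k)
      ≈⟨ solve 5 (λ a b d x y → a :* b :* d :+ (a :* x :+ y) := a :* (b :* d :+ x) :+ y) refl _ _ _ _ _ ⟩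
    f₀ * (g zero * h (suc k) + ((g ∘ suc) ✶ h) k) + (f′ ✶ (g ✶ h)) k ∎
    where
    f₀ = f zero
    f′ = f ∘ suc

  coeff-+ : ∀ p q k → coeff (p +ᴾ q) k ≈ coeff p k + coeff q k
  coeff-+ []      q       k       = sym (+-identityˡ _)
  coeff-+ (a ∷ p) []      k       = sym (+-identityʳ _)
  coeff-+ (a ∷ p) (b ∷ q) zero    = refl
  coeff-+ (a ∷ p) (b ∷ q) (suc k) = coeff-+ p q k

  coeff-map : ∀ (φ : Carrier → Carrier) → φ 0# ≈ 0# → ∀ p k → coeff (map φ p) k ≈ φ (coeff p k)
  coeff-map φ φ0 []      k       = sym φ0
  coeff-map φ φ0 (a ∷ p) zero    = refl
  coeff-map φ φ0 (a ∷ p) (suc k) = coeff-map φ φ0 p k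

  coeff-neg : ∀ p k → coeff (-ᴾ p) k ≈ - coeff p k
  coeff-neg = coeff-map -_ -0#≈0#

  coeff-* : ∀ p q k → coeff (p *ᴾ q) k ≈ (coeff p ✶ coeff q) k
  coeff-* []      q k       = sym (✶-zeroˡ (coeff q) (λ _ → refl) k)
  coeff-* (a ∷ p) q zero    = trans (coeff-+ (map (a *_) q) (0# ∷ (p *ᴾ q)) zero)
    (trans (+-identityʳ _) (coeff-map (a *_) (zeroʳ a) q zero))
  coeff-* (a ∷ p) q (suc k) = trans (coeff-+ (map (a *_) q) (0# ∷ (p *ᴾ q)) (suc k))
    (+-cong (coeff-map (a *_) (zeroʳ a) q (suc k)) (coeff-* p q k))

  -- Wrapping _≈ᴾ_ in a record keeps the two polynomials inferable.
  infix 4 _≃_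
  record _≃_ (p q : Poly) : Set ℓ where
    constructor coeffwise
    field at : p ≈ᴾ q
  open _≃_ public

  ≃-+ : ∀ {p p′ q q′} → p ≃ p′ → q ≃ q′ → p +ᴾ q ≃ p′ +ᴾ q′
  ≃-+ {p} {p′} {q} {q′} (coeffwise e) (coeffwise e′) = coeffwise λ k →
    trans (coeff-+ p q k) (trans (+-cong (e k) (e′ k)) (sym (coeff-+ p′ q′ k)))

  ≃-* : ∀ {p p′ q q′} → p ≃ p′ → q ≃ q′ → p *ᴾ q ≃ p′ *ᴾ q′
  ≃-* {p} {p′} {q} {q′} (coeffwise e) (coeffwise e′) = coeffwise λ k →
    trans (coeff-* p q k) (trans (✶-cong e e′ k) (sym (coeff-* p′ q′ k)))

  *ᴾ-comm : ∀ p q → p *ᴾ q ≃ q *ᴾ p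
  *ᴾ-comm p q = coeffwise λ k →
    trans (coeff-* p q k) (trans (✶-comm (coeff p) (coeff q) k) (sym (coeff-* q p k)))

  *ᴾ-assoc : ∀ p q r → (p *ᴾ q) *ᴾ r ≃ p *ᴾ (q *ᴾ r)
  *ᴾ-assoc p q r = coeffwise λ k → begin
    coeff ((p *ᴾ q) *ᴾ r) k                ≈⟨ coeff-* (p *ᴾ q) r k ⟩
    (coeff (p *ᴾ q) ✶ coeff r) k           ≈⟨ ✶-cong (coeff-* p q) (λ _ → refl) k ⟩
    ((coeff p ✶ coeff q) ✶ coeff r) k      ≈⟨ ✶-assoc (coeff p) (coeff q) (coeff r) k ⟩
    (coeff p ✶ (coeff q ✶ coeff r)) k      ≈⟨ ✶-cong (λ _ → refl) (coeff-* q r) k ⟨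
    (coeff p ✶ coeff (q *ᴾ r)) k           ≈⟨ coeff-* p (q *ᴾ r) k ⟨
    coeff (p *ᴾ (q *ᴾ r)) k                ∎

  *ᴾ-distribʳ : ∀ p q r → (q +ᴾ r) *ᴾ p ≃ (q *ᴾ p) +ᴾ (r *ᴾ p)
  *ᴾ-distribʳ p q r = coeffwise λ k → begin
    coeff ((q +ᴾ r) *ᴾ p) k                          ≈⟨ coeff-* (q +ᴾ r) p k ⟩
    (coeff (q +ᴾ r) ✶ coeff p) k                     ≈⟨ ✶-cong (coeff-+ q r) (λ _ → refl) k ⟩
    ((λ j → coeff q j + coeff r j) ✶ coeff p) k      ≈⟨ ✶-distribʳ (coeff q) (coeff r) (coeff p) k ⟩
    (coeff q ✶ coeff p) k + (coeff r ✶ coeff p) k    ≈⟨ +-cong (coeff-* q p k) (coeff-* r p k) ⟨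
    coeff (q *ᴾ p) k + coeff (r *ᴾ p) k              ≈⟨ coeff-+ (q *ᴾ p) (r *ᴾ p) k ⟨
    coeff ((q *ᴾ p) +ᴾ (r *ᴾ p)) k                   ∎

  *ᴾ-identityˡ : ∀ p → constant 1# *ᴾ p ≃ p
  *ᴾ-identityˡ p = coeffwise λ k → trans (coeff-* (constant 1#) p k) (unit k)
    where
    unit : coeff (constant 1#) ✶ coeff p ≗ coeff p
    unit zero    = *-identityˡ _
    unit (suc k) = trans (+-cong (*-identityˡ _) (✶-zeroˡ (coeff p) (λ _ → refl) k)) (+-identityʳ _)

  polyRing : CommutativeRing c ℓ
  polyRing = record
    { Carrier = Poly
    ; _≈_     = _≃_
    ; _+_     = _+ᴾ_
    ; _*_     = _*ᴾ_
    ; -_      = -ᴾ_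
    ; 0#      = []
    ; 1#      = constant 1#
    ; isCommutativeRing = record
      { isRing = record
        { +-isAbelianGroup = record
          { isGroup = record
            { isMonoid = record
              { isSemigroup = record
                { isMagma = record
                  { isEquivalence = record
                    { refl  = coeffwise λ k → refl
                    ; sym   = λ (coeffwise e) → coeffwise λ k → sym (e k)
                    ; trans = λ (coeffwise e) (coeffwise e′) → coeffwise λ k → trans (e k) (e′ k)
                    }
                  ; ∙-cong = ≃-+
                  }
                ; assoc = λ p q r → coeffwise λ k →
                    trans (coeff-+ (p +ᴾ q) r k) (trans (+-congʳ (coeff-+ p q k)) (trans (+-assoc _ _ _)
                      (sym (trans (coeff-+ p (q +ᴾ r) k) (+-congˡ (coeff-+ q r k))))))
                }
              ; identity = (λ p → coeffwise λ k → refl)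
                         , (λ p → coeffwise λ k → trans (coeff-+ p [] k) (+-identityʳ _))
              }
            ; inverse = (λ p → coeffwise λ k →
                          trans (coeff-+ (-ᴾ p) p k) (trans (+-congʳ (coeff-neg p k)) (-‿inverseˡ _)))
                      , (λ p → coeffwise λ k →
                          trans (coeff-+ p (-ᴾ p) k) (trans (+-congˡ (coeff-neg p k)) (-‿inverseʳ _)))
            ; ⁻¹-cong = λ {p} {q} (coeffwise e) → coeffwise λ k →
                trans (coeff-neg p k) (trans (-‿cong (e k)) (sym (coeff-neg q k)))
            }
          ; comm = λ p q → coeffwise λ k →
              trans (coeff-+ p q k) (trans (+-comm _ _) (sym (coeff-+ q p k)))
          }
        ; *-cong = ≃-*
        ; *-assoc = *ᴾ-assoc
        ; *-identity = *ᴾ-identityˡ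
                     , (λ p → ≃-trans (*ᴾ-comm p (constant 1#)) (*ᴾ-identityˡ p))
        ; distrib = (λ p q r → ≃-trans (*ᴾ-comm p (q +ᴾ r)) (≃-trans (*ᴾ-distribʳ p q r)
                      (≃-+ (*ᴾ-comm q p) (*ᴾ-comm r p))))
                  , *ᴾ-distribʳ
        }
      ; *-comm = *ᴾ-comm
      }
    }
    where
    ≃-trans : ∀ {p q r} → p ≃ q → q ≃ r → p ≃ r
    ≃-trans (coeffwise e) (coeffwise e′) = coeffwise λ k → trans (e k) (e′ k)

  module Det  = Determinant (CommutativeRing.rawRing polyRing)
  module Detᴾ = Determinant polyRawRing

  -- The two raw rings have the same operations and differ only in their equality relation, so both
  -- determinants are built alike.
  det-polyRawRing : ∀ {n} (M : Matrix Poly n) → Detᴾ.det M ≡ Det.det M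
  det-polyRawRing {zero}  M = ≡.refl
  det-polyRawRing {suc n} M = sum-cong-≗ λ j → ≡.cong₂ _*ᴾ_ (sign-≡ (toℕ j))
    (≡.cong (M zero j *ᴾ_) (det-polyRawRing λ i k → M (suc i) (punchIn j k)))
    where
    open MonoidSum (CommutativeRing.+-monoid polyRing) using (sum-cong-≗)
    sign-≡ : ∀ k → Detᴾ.sign k ≡ Det.sign k
    sign-≡ zero    = ≡.refl
    sign-≡ (suc k) = ≡.cong -ᴾ_ (sign-≡ k)

  module _ where
    private module R = CommutativeRing polyRing
    open MonoidSum R.+-monoid using (sum)

    -- A strict bound instead of a degree: lists may end in zeros, and equality of coefficients is
    -- not decidable over a general ring. The zero polynomial has bound 0.
    DegreeBelow : ℕ → Poly → Set ℓ
    DegreeBelow n p = ∀ k → n ≤ℕ k → coeff p k ≈ 0#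

    record Monic (d : ℕ) (p : Poly) : Set ℓ where
      constructor monic
      field
        bound   : DegreeBelow (suc d) p
        leading : coeff p d ≈ 1#
    open Monic public

    below-cong : ∀ {n p q} → p ≃ q → DegreeBelow n p → DegreeBelow n q
    below-cong (coeffwise e) b k n≤k = trans (sym (e k)) (b k n≤k)

    below-weaken : ∀ {m n p} → m ≤ℕ n → DegreeBelow m p → DegreeBelow n p
    below-weaken m≤n b k n≤k = b k (≤-trans m≤n n≤k)

    below-length : ∀ p → DegreeBelow (length p) p
    below-length []      k       _         = refl
    below-length (a ∷ p) (suc k) (s≤s n≤k) = below-length p k n≤k

    below-+ : ∀ {n} p q → DegreeBelow n p → DegreeBelow n q → DegreeBelow n (p +ᴾ q)
    below-+ p q b b′ k n≤k =
      trans (coeff-+ p q k) (trans (+-cong (b k n≤k) (b′ k n≤k)) (+-identityʳ _))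

    below-neg : ∀ {n} p → DegreeBelow n p → DegreeBelow n (-ᴾ p)
    below-neg p b k n≤k = trans (coeff-neg p k) (trans (-‿cong (b k n≤k)) -0#≈0#)

    below-sum : ∀ {n m} (p : Vector Poly m) → (∀ i → DegreeBelow n (p i)) → DegreeBelow n (sum p)
    below-sum {m = zero}  p b k n≤k = refl
    below-sum {m = suc m} p b = below-+ (p zero) (sum (p ∘ suc)) (b zero) (below-sum (p ∘ suc) (b ∘ suc))

    private
      -- The top exponents are at most `a - 1` and `b`. Shifting only one of the bounds avoids
      -- subtraction and includes a zero left factor at `a = 0`.
      ✶-below : ∀ a b {f g} → (∀ k → a ≤ℕ k → f k ≈ 0#) → (∀ k → suc b ≤ℕ k → g k ≈ 0#) →
        ∀ k → a +ℕ b ≤ℕ k → (f ✶ g) k ≈ 0#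
      ✶-below zero    b {g = g} fb gb k _ = ✶-zeroˡ g (λ j → fb j z≤n) k
      ✶-below (suc a) b fb gb (suc k) (s≤s ab≤k) = trans
        (+-cong (trans (*-congˡ (gb (suc k) (s≤s (≤-trans (m≤n+m b a) ab≤k)))) (zeroʳ _))
          (✶-below a b (λ j a≤j → fb (suc j) (s≤s a≤j)) gb k ab≤k))
        (+-identityʳ _)

      ✶-leading : ∀ d e {f g} → (∀ k → suc d ≤ℕ k → f k ≈ 0#) → (∀ k → suc e ≤ℕ k → g k ≈ 0#) →
        (f ✶ g) (d +ℕ e) ≈ f d * g e
      ✶-leading zero zero        fb gb = refl
      ✶-leading zero (suc e) {f} {g} fb gb =
        trans (+-congˡ (✶-zeroˡ g (λ j → fb (suc j) (s≤s z≤n)) e)) (+-identityʳ _)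
      ✶-leading (suc d) e {f} {g} fb gb = trans
        (+-cong (trans (*-congˡ (gb (suc (d +ℕ e)) (s≤s (m≤n+m e d)))) (zeroʳ _))
          (✶-leading d e (λ j d<j → fb (suc j) (s≤s d<j)) gb))
        (+-identityˡ _)

    below-* : ∀ a b p q → DegreeBelow a p → DegreeBelow (suc b) q → DegreeBelow (a +ℕ b) (p *ᴾ q)
    below-* a b p q pb qb k ab≤k = trans (coeff-* p q k) (✶-below a b pb qb k ab≤k)

    leading-* : ∀ d e p q → DegreeBelow (suc d) p → DegreeBelow (suc e) q →
      coeff (p *ᴾ q) (d +ℕ e) ≈ coeff p d * coeff q e
    leading-* d e p q pb qb = trans (coeff-* p q (d +ℕ e)) (✶-leading d e pb qb)

    monic-cong : ∀ {d p q} → p ≃ q → Monic d p → Monic d q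
    monic-cong e (monic b l) = monic (below-cong e b) (trans (sym (at e _)) l)

    monic-* : ∀ {d e} p q → Monic d p → Monic e q → Monic (d +ℕ e) (p *ᴾ q)
    monic-* {d} {e} p q (monic pb pl) (monic qb ql) = monic
      (below-* (suc d) e p q pb qb)
      (trans (leading-* d e p q pb qb) (trans (*-cong pl ql) (*-identityˡ _)))

    monic-+-below : ∀ {d} p q → Monic d p → DegreeBelow d q → Monic d (p +ᴾ q)
    monic-+-below {d} p q (monic pb pl) qb = monic
      (below-+ p q pb (below-weaken {p = q} (n≤1+n d) qb))
      (trans (coeff-+ p q d) (trans (+-cong pl (qb d ≤-refl)) (+-identityʳ _)))

    constant-below : ∀ a → DegreeBelow 1 (constant a)
    constant-below a (suc k) _ = refl

    monic-1 : Monic 0 (constant 1#)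
    monic-1 = monic (constant-below 1#) refl

    -- The coefficients of t beyond s vanish from the top down.
    monic-divides-below : ∀ {d} g t s → Monic d g → DegreeBelow (d +ℕ s) (g *ᴾ t) → DegreeBelow s t
    monic-divides-below {d} g t s (monic gb gl) gtb = descend (length t) (below-length t)
      where
      descend : ∀ b → DegreeBelow b t → DegreeBelow s t
      descend zero    tb = λ k _ → tb k z≤n
      descend (suc b) tb k s≤k with s ≤? b
      ... | no  s≰b = tb k (≤-trans (≰⇒> s≰b) s≤k)
      ... | yes s≤b = descend b below k s≤k
        where
        t[b]≈0 : coeff t b ≈ 0#
        t[b]≈0 = begin
          coeff t b                  ≈⟨ *-identityˡ _ ⟨
          1# * coeff t b             ≈⟨ *-congʳ gl ⟨
          coeff g d * coeff t b      ≈⟨ leading-* d b g t gb tb ⟨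
          coeff (g *ᴾ t) (d +ℕ b)    ≈⟨ gtb (d +ℕ b) (+-monoʳ-≤ d s≤b) ⟩
          0#                         ∎
        below : DegreeBelow b t
        below j b≤j with m≤n⇒m<n∨m≡n b≤j
        ... | inj₁ b<j    = tb j b<j
        ... | inj₂ ≡.refl = t[b]≈0

    monic-divides : ∀ {d} g t → Monic d g → DegreeBelow d (g *ᴾ t) → t ≃ []
    monic-divides {d} g t gm gtb = coeffwise λ k →
      monic-divides-below g t 0 gm (below-weaken {p = g *ᴾ t} (m≤m+n d 0) gtb) k z≤n

    -- The product of `g` with `p - q` vanishes, so it meets every degree bound, and a leading
    -- coefficient 1 then leaves no room for a nonzero cofactor.
    monic-cancel : ∀ {d} g p q → Monic d g → g *ᴾ p ≃ g *ᴾ q → p ≃ q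
    monic-cancel {d} g p q gm gp≃gq = x∙y⁻¹≈ε⇒x≈y p q (monic-divides g (p +ᴾ (-ᴾ q)) gm vanishing)
      where
      open GroupProperties R.+-group using (x∙y⁻¹≈ε⇒x≈y; x≈y⇒x∙y⁻¹≈ε)
      open RingProperties R.ring using (x[y-z]≈xy-xz)
      vanishing : DegreeBelow d (g *ᴾ (p +ᴾ (-ᴾ q)))
      vanishing k _ = at (R.trans (x[y-z]≈xy-xz g p q) (x≈y⇒x∙y⁻¹≈ε gp≃gq)) k

    total : ∀ {n} → Vector ℕ n → ℕ
    total = foldr _+ℕ_ 0

    sign-below : ∀ k → DegreeBelow 1 (Det.sign k)
    sign-below zero    = bound monic-1
    sign-below (suc k) = below-neg (Det.sign k) (sign-below k)

    private
      minor : ∀ {n} → Matrix Poly (suc n) → Fin (suc n) → Poly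
      minor M j = Det.det (λ i k → M (suc i) (punchIn j k))

      term : ∀ {n} → Matrix Poly (suc n) → Fin (suc n) → Poly
      term M j = Det.sign (toℕ j) *ᴾ (M zero j *ᴾ minor M j)

    det-below : ∀ {n} (M : Matrix Poly n) (d : Vector ℕ n) →
      (∀ i j → DegreeBelow (suc (d i)) (M i j)) → DegreeBelow (suc (total d)) (Det.det M)
    det-below {zero}  M d b = bound monic-1
    det-below {suc n} M d b = below-sum (term M) λ j →
      below-* 1 (total d) (Det.sign (toℕ j)) (M zero j *ᴾ minor M j) (sign-below (toℕ j))
        (below-* (suc (d zero)) (total (d ∘ suc)) (M zero j) (minor M j) (b zero j)
          (det-below (λ i k → M (suc i) (punchIn j k)) (d ∘ suc) λ i k → b (suc i) (punchIn j k)))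

    -- The degree may vary from row to row, since the root row of the matrix behind `g` is constant.
    -- The diagonal term of the expansion is monic of full degree; every other term contains an
    -- off-diagonal entry of row 0 and so stays strictly below.
    det-monic : ∀ {n} (M : Matrix Poly n) (d : Vector ℕ n) →
      (∀ i → Monic (d i) (M i i)) → (∀ i j → i ≢ j → DegreeBelow (d i) (M i j)) →
      Monic (total d) (Det.det M)
    det-monic {zero}  M d mon off = monic-1
    det-monic {suc n} M d mon off = monic-+-below (term M zero) (sum (term M ∘ suc))
      (monic-* (Det.sign 0) (M zero zero *ᴾ minor M zero) monic-1 (monic-* (M zero zero) (minor M zero) (mon zero)
        (det-monic (λ i k → M (suc i) (suc k)) (d ∘ suc) (mon ∘ suc)
          λ i k i≢k → off (suc i) (suc k) (i≢k ∘ suc-injective))))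
      (below-sum (term M ∘ suc) λ j → sign-* (suc (toℕ j)) (M zero (suc j) *ᴾ minor M (suc j))
        (below-* (d zero) (total (d ∘ suc)) (M zero (suc j)) (minor M (suc j)) (off zero (suc j) λ ())
          (det-below (λ i k → M (suc i) (punchIn (suc j) k)) (d ∘ suc) λ i k → entry (suc i) (punchIn (suc j) k))))
      where
      entry : ∀ i j → DegreeBelow (suc (d i)) (M i j)
      entry i j with i ≟ j
      ... | yes ≡.refl = bound (mon i)
      ... | no  i≢j    = below-weaken {p = M i j} (n≤1+n (d i)) (off i j i≢j)
      sign-* : ∀ k {m} p → DegreeBelow m p → DegreeBelow m (Det.sign k *ᴾ p)
      sign-* zero    p b = below-cong (R.sym (R.*-identityˡ p)) b
      sign-* (suc k) p b = below-cong (-‿distribˡ-* (Det.sign k) p)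
        (below-neg (Det.sign k *ᴾ p) (sign-* k p b))
        where open RingProperties R.ring using (-‿distribˡ-*)

    linear : Carrier → Poly
    linear a = X +ᴾ (-ᴾ constant a)

    linear-monic : ∀ a → Monic 1 (linear a)
    linear-monic a = monic (λ { (suc (suc k)) _ → refl ; (suc zero) (s≤s ()) }) refl

    -- Over an ordered field this unfolds to the `fromRoots` of `Spectra`, so results pass between
    -- the two without conversion.
    fromRoots : List Carrier → Poly
    fromRoots = List.foldr (λ a p → linear a *ᴾ p) (constant 1#)

    fromRoots-monic : ∀ as → Monic (length as) (fromRoots as)
    fromRoots-monic []       = monic-1
    fromRoots-monic (a ∷ as) = monic-* (linear a) (fromRoots as) (linear-monic a) (fromRoots-monic as)

-- Homogenising polynomials in f and g.

module Homogenisation {c ℓ c′ ℓ′} (K : CommutativeRing c ℓ) (S : CommutativeRing c′ ℓ′)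
  (ι : CommutativeRing.Carrier K → CommutativeRing.Carrier S)
  (ι-hom : IsRingHomomorphism (CommutativeRing.rawRing K) (CommutativeRing.rawRing S) ι)
  (f g : CommutativeRing.Carrier S) where

  private
    module K = CommutativeRing K
  open Polynomial K
  open PolynomialRing K
  open CommutativeRing S hiding (zero)
  open Determinant rawRing
  open IsRingHomomorphism ι-hom
  open RingProperties ring using (-1*x≈-x; -‿distribˡ-*)
  open MonoidSum +-monoid using (sum; sum-cong-≋)
  open SemiringExp semiring using (_^_)
  open SemiringSolver commutativeSemiring using (solve; _:=_; _:+_; _:*_)
  open SetoidReasoning setoid

  -- homogenise r c = Σₖ cₖ fᵏ gʳ⁻ᵏ, over k ≤ r.
  homogenise : ℕ → Sequence → Carrier
  homogenise zero    c = ι (c 0)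
  homogenise (suc r) c = ι (c 0) * g ^ suc r + f * homogenise r (c ∘ suc)

  homogenise-cong : ∀ r {c d} → c ≗ d → homogenise r c ≈ homogenise r d
  homogenise-cong zero    c≗d = ⟦⟧-cong (c≗d 0)
  homogenise-cong (suc r) c≗d =
    +-cong (*-congʳ (⟦⟧-cong (c≗d 0))) (*-congˡ (homogenise-cong r (c≗d ∘ suc)))

  homogenise-+ : ∀ r c d → homogenise r (λ k → c k K.+ d k) ≈ homogenise r c + homogenise r d
  homogenise-+ zero    c d = +-homo (c 0) (d 0)
  homogenise-+ (suc r) c d = trans
    (+-cong (*-congʳ (+-homo (c 0) (d 0))) (*-congˡ (homogenise-+ r (c ∘ suc) (d ∘ suc))))
    (solve 6 (λ x y w f u v → (x :+ y) :* w :+ f :* (u :+ v) := (x :* w :+ f :* u) :+ (y :* w :+ f :* v)) refl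
      _ _ _ _ _ _)

  homogenise-scale : ∀ r a c → homogenise r (λ k → a K.* c k) ≈ ι a * homogenise r c
  homogenise-scale zero    a c = *-homo a (c 0)
  homogenise-scale (suc r) a c = trans
    (+-cong (*-congʳ (*-homo a (c 0))) (*-congˡ (homogenise-scale r a (c ∘ suc))))
    (solve 5 (λ a x w f u → a :* x :* w :+ f :* (a :* u) := a :* (x :* w :+ f :* u)) refl _ _ _ _ _)

  homogenise-neg : ∀ r c → homogenise r (λ k → K.- c k) ≈ - homogenise r c
  homogenise-neg r c = begin
    homogenise r (λ k → K.- c k)               ≈⟨ homogenise-cong r (λ k → KP.-1*x≈-x (c k)) ⟨
    homogenise r (λ k → K.- K.1# K.* c k)      ≈⟨ homogenise-scale r (K.- K.1#) c ⟩
    ι (K.- K.1#) * homogenise r c              ≈⟨ *-congʳ (trans (-‿homo K.1#) (-‿cong 1#-homo)) ⟩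
    - 1# * homogenise r c                      ≈⟨ -1*x≈-x _ ⟩
    - homogenise r c                           ∎
    where module KP = RingProperties K.ring

  -- Raising the nominal degree above a vanishing top coefficient adds one factor `g` to each term.
  homogenise-lower : ∀ r c → c (suc r) K.≈ K.0# → homogenise (suc r) c ≈ g * homogenise r c
  homogenise-lower zero c c₁≈0 = trans
    (+-cong (*-congˡ (*-identityʳ g)) (trans (*-congˡ (trans (⟦⟧-cong c₁≈0) 0#-homo)) (zeroʳ f)))
    (trans (+-identityʳ _) (*-comm _ _))
  homogenise-lower (suc r) c eq = trans
    (+-congˡ (*-congˡ (homogenise-lower r (c ∘ suc) eq)))
    (solve 5 (λ x g w f u → x :* (g :* w) :+ f :* (g :* u) := g :* (x :* w :+ f :* u)) refl _ _ _ _ _)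

  -- Multiplicativity for a left factor of degree at most one is enough: both the Laplace expansion
  -- and the product over the roots peel off one such factor at a time, and nominal degrees add.
  homogenise-linear : ∀ r l p → DegreeBelow 2 l → DegreeBelow (suc r) p →
    homogenise (suc r) (coeff (l *ᴾ p)) ≈ homogenise 1 (coeff l) * homogenise r (coeff p)
  homogenise-linear r l p lb pb = begin
    homogenise (suc r) (coeff (l *ᴾ p))
      ≈⟨ homogenise-cong (suc r) product ⟩
    homogenise (suc r) (λ k → (l₀ K.* coeff p k) K.+ shifted k)
      ≈⟨ homogenise-+ (suc r) (λ k → l₀ K.* coeff p k) shifted ⟩
    homogenise (suc r) (λ k → l₀ K.* coeff p k) + homogenise (suc r) shifted
      ≈⟨ +-cong
          (trans (homogenise-scale (suc r) l₀ (coeff p)) (*-congˡ (homogenise-lower r (coeff p) (pb (suc r) ≤-refl))))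
          (trans (+-cong (trans (*-congʳ 0#-homo) (zeroˡ _)) (*-congˡ (homogenise-scale r l₁ (coeff p)))) (+-identityˡ _)) ⟩
    ι l₀ * (g * h) + f * (ι l₁ * h)
      ≈⟨ solve 5 (λ x g y f h → x :* (g :* h) :+ f :* (y :* h) := (x :* g :+ f :* y) :* h) refl _ _ _ _ _ ⟩
    (ι l₀ * g + f * ι l₁) * h
      ≈⟨ *-congʳ (+-congʳ (*-congˡ (*-identityʳ g))) ⟨
    homogenise 1 (coeff l) * h ∎
    where
    l₀ = coeff l 0
    l₁ = coeff l 1
    h  = homogenise r (coeff p)
    -- The product is split as `l₀ p + X (l₁ p)`. The first summand has a spare degree and
    -- contributes `g`, the second contributes `f` through the shift.
    shifted : Sequence
    shifted zero    = K.0#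
    shifted (suc k) = l₁ K.* coeff p k
    tail : ∀ k → ((coeff l ∘ suc) ✶ coeff p) k K.≈ l₁ K.* coeff p k
    tail zero    = K.refl
    tail (suc k) = K.trans
      (K.+-congˡ (✶-zeroˡ (coeff p) (λ j → lb (suc (suc j)) (s≤s (s≤s z≤n))) k)) (K.+-identityʳ _)
    product : ∀ k → coeff (l *ᴾ p) k K.≈ (l₀ K.* coeff p k) K.+ shifted k
    product zero    = K.trans (coeff-* l p zero) (K.sym (K.+-identityʳ _))
    product (suc k) = K.trans (coeff-* l p (suc k)) (K.+-congˡ (tail k))

  homogenise-sum : ∀ r {n} (p : Vector Poly n) →
    homogenise r (coeff (MonoidSum.sum (CommutativeRing.+-monoid polyRing) p)) ≈
    sum (λ j → homogenise r (coeff (p j)))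
  homogenise-sum r {zero}  p = zero-seq r
    where
    zero-seq : ∀ r → homogenise r (λ _ → K.0#) ≈ 0#
    zero-seq zero    = 0#-homo
    zero-seq (suc r) = trans (+-cong (trans (*-congʳ 0#-homo) (zeroˡ _))
      (trans (*-congˡ (zero-seq r)) (zeroʳ f))) (+-identityʳ _)
  homogenise-sum r {suc n} p = trans (homogenise-cong r (coeff-+ (p zero) _))
    (trans (homogenise-+ r (coeff (p zero)) _) (+-congˡ (homogenise-sum r (p ∘ suc))))

  homogenise-sign : ∀ r k p → homogenise r (coeff (Det.sign k *ᴾ p)) ≈ sign k * homogenise r (coeff p)
  homogenise-sign r zero    p = trans (homogenise-cong r (at (*ᴾ-identityˡ p))) (sym (*-identityˡ _))
  homogenise-sign r (suc k) p = begin
    homogenise r (coeff ((-ᴾ Det.sign k) *ᴾ p))           ≈⟨ homogenise-cong r (at (PP.-‿distribˡ-* (Det.sign k) p)) ⟨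
    homogenise r (coeff (-ᴾ (Det.sign k *ᴾ p)))           ≈⟨ homogenise-cong r (coeff-neg (Det.sign k *ᴾ p)) ⟩
    homogenise r (λ j → K.- coeff (Det.sign k *ᴾ p) j)    ≈⟨ homogenise-neg r (coeff (Det.sign k *ᴾ p)) ⟩
    - homogenise r (coeff (Det.sign k *ᴾ p))              ≈⟨ -‿cong (homogenise-sign r k p) ⟩
    - (sign k * homogenise r (coeff p))                   ≈⟨ -‿distribˡ-* _ _ ⟩
    - sign k * homogenise r (coeff p)                     ∎
    where module PP = RingProperties (CommutativeRing.ring polyRing)

  -- Each row contributes nominal degree one. A Laplace term of an order `suc n` determinant is thus
  -- a linear entry times a minor of nominal degree `n`, exactly the case handled by
  -- `homogenise-linear`.
  homogenise-det : ∀ {n} (M : Matrix Poly n) → (∀ i j → DegreeBelow 2 (M i j)) →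
    homogenise n (coeff (Det.det M)) ≈ det (λ i j → homogenise 1 (coeff (M i j)))
  homogenise-det {zero}  M Mb = 1#-homo
  homogenise-det {suc n} M Mb = trans
    (homogenise-sum (suc n) (λ j → Det.sign (toℕ j) *ᴾ (M zero j *ᴾ minor j)))
    (sum-cong-≋ λ j → trans
      (homogenise-sign (suc n) (toℕ j) (M zero j *ᴾ minor j))
      (*-congˡ (trans (homogenise-linear n (M zero j) (minor j) (Mb zero j) (minor-below j))
        (*-congˡ (homogenise-det (λ i k → M (suc i) (punchIn j k)) λ i k → Mb (suc i) (punchIn j k))))))
    where
    minor : Fin (suc n) → Poly
    minor j = Det.det (λ i k → M (suc i) (punchIn j k))
    total-ones : ∀ n → total {n} (const 1) ≡ n
    total-ones zero    = ≡.refl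
    total-ones (suc n) = ≡.cong suc (total-ones n)
    minor-below : ∀ j → DegreeBelow (suc n) (minor j)
    minor-below j = ≡.subst (λ d → DegreeBelow (suc d) (minor j)) (total-ones n)
      (det-below (λ i k → M (suc i) (punchIn j k)) (const 1) λ i k → Mb (suc i) (punchIn j k))

  homogenise-fromRoots : ∀ as →
    homogenise (length as) (coeff (fromRoots as)) ≈
    List.foldr (λ a x → (f + - (ι a * g)) * x) 1# as
  homogenise-fromRoots []       = 1#-homo
  homogenise-fromRoots (a ∷ as) = trans
    (homogenise-linear (length as) (linear a) (fromRoots as) (bound (linear-monic a)) (bound (fromRoots-monic as)))
    (*-cong (homogenise-linearFactor a) (homogenise-fromRoots as))
    where
    homogenise-linearFactor : ∀ a → homogenise 1 (coeff (linear a)) ≈ f + - (ι a * g)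
    homogenise-linearFactor a = begin
      ι (K.0# K.+ K.- a) * (g * 1#) + f * ι K.1#
        ≈⟨ +-cong (*-cong (⟦⟧-cong (K.+-identityˡ _)) (*-identityʳ g)) (trans (*-congˡ 1#-homo) (*-identityʳ f)) ⟩
      ι (K.- a) * g + f
        ≈⟨ +-congʳ (trans (*-congʳ (-‿homo a)) (sym (-‿distribˡ-* _ _))) ⟩
      - (ι a * g) + f
        ≈⟨ +-comm _ _ ⟩
      f + - (ι a * g) ∎

-- Identities in an abstract commutative ring.

module Identities {c ℓ} (S : CommutativeRing c ℓ) where
  open CommutativeRing S
  open SemiringSolver commutativeSemiring using (solve; _:=_; _:+_; _:*_)

  *-swap : ∀ x y z → x * (y * z) ≈ y * (x * z)
  *-swap = solve 3 (λ x y z → x :* (y :* z) := y :* (x :* z)) refl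

  -- One Horner step, with `l + a` in the role of X: the new quotient is `r + X q` and the new
  -- remainder `b + a r`.
  division-step : ∀ l a q r b →
    b + (l + a) * (l * q + r) ≈ l * (r + (l + a) * q) + (b + a * r)
  division-step = solve 5 (λ l a q r b →
    b :+ (l :+ a) :* (l :* q :+ r) := l :* (r :+ (l :+ a) :* q) :+ (b :+ a :* r)) refl

  division-product : ∀ l p x q y →
    (l * p + x) * (l * q + y) ≈ l * (p * (l * q + y) + x * q) + x * y
  division-product = solve 5 (λ l p x q y →
    (l :* p :+ x) :* (l :* q :+ y) := l :* (p :* (l :* q :+ y) :+ x :* q) :+ x :* y) refl

-- Division by linear polynomials and splitting of monic factors.

module Factorisation {c ℓ₁ ℓ₂} (K : OrderedField c ℓ₁ ℓ₂) where
  open OrderedField K hiding (zero; _≤_)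
  open Polynomial commutativeRing
  open PolynomialRing commutativeRing
  open Permutation setoid using (_↭_; prep; swap; ↭-refl; ↭-sym; ↭-trans; ↭-prep)
    renaming (refl to ↭-pointwise; trans to ↭-compose)
  open PermutationProperties setoid using (↭-shift; ++⁺ˡ)

  private
    module P = CommutativeRing polyRing
  open Identities polyRing using (*-swap; division-step; division-product)
  open SetoidReasoning P.setoid

  product : ∀ {n} → Vector Poly n → Poly
  product = foldr _*ᴾ_ (constant 1#)

  product-cong : ∀ {n} {p q : Vector Poly n} → (∀ i → p i ≃ q i) → product p ≃ product q
  product-cong {zero}  eq = P.refl
  product-cong {suc n} eq = ≃-* (eq zero) (product-cong (eq ∘ suc))

  fromRoots-++ : ∀ σ τ → fromRoots (σ ++ τ) ≃ fromRoots σ *ᴾ fromRoots τ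
  fromRoots-++ []      τ = P.sym (P.*-identityˡ _)
  fromRoots-++ (a ∷ σ) τ = P.trans (≃-* (P.refl {linear a}) (fromRoots-++ σ τ))
    (P.sym (*ᴾ-assoc (linear a) (fromRoots σ) (fromRoots τ)))

  fromRoots-concat : ∀ {n} (μ : Fin n → List Carrier) →
    fromRoots (concat (tabulate μ)) ≃ product (λ j → fromRoots (μ j))
  fromRoots-concat {zero}  μ = P.refl
  fromRoots-concat {suc n} μ = P.trans (fromRoots-++ (μ zero) (concat (tabulate (μ ∘ suc))))
    (≃-* (P.refl {fromRoots (μ zero)}) (fromRoots-concat (μ ∘ suc)))

  constant-cong : ∀ {a b} → a ≈ b → constant a ≃ constant b
  constant-cong a≈b = coeffwise λ { zero → a≈b ; (suc k) → refl }

  linear-cong : ∀ {a b} → a ≈ b → linear a ≃ linear b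
  linear-cong a≈b = P.+-congˡ {X} (P.-‿cong (constant-cong a≈b))

  fromRoots-↭ : ∀ {σ τ} → σ ↭ τ → fromRoots σ ≃ fromRoots τ
  fromRoots-↭ (↭-pointwise σ≋τ)     = pointwise σ≋τ
    where
    pointwise : ∀ {σ τ} → Pointwise _≈_ σ τ → fromRoots σ ≃ fromRoots τ
    pointwise []          = P.refl
    pointwise (a≈b ∷ σ≋τ) = ≃-* (linear-cong a≈b) (pointwise σ≋τ)
  fromRoots-↭ (prep a≈b σ↭τ)  = ≃-* (linear-cong a≈b) (fromRoots-↭ σ↭τ)
  fromRoots-↭ (swap {xs = σ} {τ} {a} {b} {a′} {b′} a≈a′ b≈b′ σ↭τ) = begin
    linear a *ᴾ (linear b *ᴾ fromRoots σ)
      ≈⟨ ≃-* (linear-cong a≈a′) (≃-* (linear-cong b≈b′) (fromRoots-↭ σ↭τ)) ⟩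
    linear a′ *ᴾ (linear b′ *ᴾ fromRoots τ)
      ≈⟨ *-swap (linear a′) (linear b′) (fromRoots τ) ⟩
    linear b′ *ᴾ (linear a′ *ᴾ fromRoots τ) ∎
  fromRoots-↭ (↭-compose σ↭τ τ↭υ) = P.trans (fromRoots-↭ σ↭τ) (fromRoots-↭ τ↭υ)

  constant-* : ∀ a b → constant (a * b) ≃ constant a *ᴾ constant b
  constant-* a b = coeffwise λ { zero → sym (+-identityʳ _) ; (suc k) → refl }

  constant-0 : ∀ {a} → a ≈ 0# → constant a ≃ []
  constant-0 a≈0 = coeffwise λ { zero → a≈0 ; (suc k) → refl }

  linear-+ : ∀ a → linear a +ᴾ constant a ≃ X
  linear-+ a = P.trans (P.+-assoc X (-ᴾ constant a) (constant a))
    (P.trans (P.+-congˡ {X} (P.-‿inverseˡ (constant a))) (P.+-identityʳ X))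

  ∷-decompose : ∀ b p → b ∷ p ≃ constant b +ᴾ (X *ᴾ p)
  ∷-decompose b p = coeffwise λ
    { zero    → sym (trans (coeff-+ (constant b) (X *ᴾ p) 0)
        (trans (+-congˡ (trans (coeff-* X p 0) (zeroˡ _))) (+-identityʳ b)))
    ; (suc k) → sym (trans (coeff-+ (constant b) (X *ᴾ p) (suc k))
        (trans (+-identityˡ _) (trans (coeff-* X p (suc k)) (trans (+-congʳ (zeroˡ _))
          (trans (+-identityˡ _) (shifted p k))))))
    }
    where
    shifted : ∀ p k → ((coeff X ∘ suc) ✶ coeff p) k ≈ coeff p k
    shifted p zero    = *-identityˡ _
    shifted p (suc k) = trans (+-cong (*-identityˡ _) (✶-zeroˡ (coeff p) (λ _ → refl) k)) (+-identityʳ _)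

  -- Synthetic division: the quotient collects the intermediate Horner values, and the remainder is
  -- the value of `p` at `a`.
  divide : ∀ a p → Σ[ q ∈ Poly ] Σ[ r ∈ Carrier ] p ≃ linear a *ᴾ q +ᴾ constant r
  divide a []      = [] , 0# , P.sym (P.trans (P.+-cong (P.zeroʳ (linear a)) (constant-0 refl)) (P.+-identityʳ []))
  divide a (b ∷ p) with divide a p
  ... | q , r , p≃ = (r ∷ q) , (b + a * r) , (begin
    b ∷ p
      ≈⟨ ∷-decompose b p ⟩
    constant b +ᴾ X *ᴾ p
      ≈⟨ P.+-congˡ {constant b} (≃-* (P.sym (linear-+ a)) p≃) ⟩
    constant b +ᴾ (linear a +ᴾ constant a) *ᴾ (linear a *ᴾ q +ᴾ constant r)
      ≈⟨ division-step (linear a) (constant a) q (constant r) (constant b) ⟩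
    linear a *ᴾ (constant r +ᴾ (linear a +ᴾ constant a) *ᴾ q) +ᴾ (constant b +ᴾ constant a *ᴾ constant r)
      ≈⟨ ≃-+ (≃-* (P.refl {linear a})
               (P.trans (P.+-congˡ {constant r} (≃-* (linear-+ a) (P.refl {q}))) (P.sym (∷-decompose r q))))
             (P.+-congˡ {constant b} (P.sym (constant-* a r))) ⟩
    linear a *ᴾ (r ∷ q) +ᴾ constant (b + a * r) ∎)

  remainder-zero : ∀ a t r → linear a *ᴾ t ≃ constant r → r ≈ 0#
  remainder-zero a t r eq = sym (at (P.trans (P.sym (P.trans (≃-* (P.refl {linear a}) t≃0) (P.zeroʳ (linear a)))) eq) 0)
    where
    t≃0 : t ≃ []
    t≃0 = monic-divides (linear a) t (linear-monic a) (below-cong (P.sym eq) (constant-below r))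

  -- Decidable equality makes the choice of the vanishing factor effective.
  integral : ∀ x y → x * y ≈ 0# → x ≈ 0# ⊎ y ≈ 0#
  integral x y xy≈0 with IsDecTotalOrder._≟_ isDecTotalOrder x 0#
  ... | yes x≈0 = inj₁ x≈0
  ... | no  x≉0 = let (x⁻¹ , xx⁻¹≈1) = inverse x x≉0 in inj₂ (
    trans (sym (*-identityˡ y)) (trans (*-congʳ (trans (sym xx⁻¹≈1) (*-comm x x⁻¹)))
      (trans (*-assoc x⁻¹ x y) (trans (*-congˡ xy≈0) (zeroʳ x⁻¹)))))

  -- Modulo `linear a` the product of the two remainders is congruent to `p *ᴾ q`, hence to zero. As
  -- a constant it must be zero itself, so one of the remainders vanishes.
  linear-prime : ∀ a p q s → p *ᴾ q ≃ linear a *ᴾ s →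
    (Σ[ t ∈ Poly ] p ≃ linear a *ᴾ t) ⊎ (Σ[ t ∈ Poly ] q ≃ linear a *ᴾ t)
  linear-prime a p q s pq≃ls =
    let (p′ , x , p≃) = divide a p
        (q′ , y , q≃) = divide a q
    in Sum.map (λ x≈0 → p′ , exact p′ x≈0 p≃) (λ y≈0 → q′ , exact q′ y≈0 q≃)
         (integral x y (remainders p′ x p≃ q′ y q≃))
    where
    l = linear a
    exact : ∀ {p} p′ {x} → x ≈ 0# → p ≃ l *ᴾ p′ +ᴾ constant x → p ≃ l *ᴾ p′
    exact p′ x≈0 p≃ = P.trans p≃ (P.trans (P.+-congˡ {l *ᴾ p′} (constant-0 x≈0)) (P.+-identityʳ _))
    remainders : ∀ p′ x → p ≃ l *ᴾ p′ +ᴾ constant x → ∀ q′ y → q ≃ l *ᴾ q′ +ᴾ constant y → x * y ≈ 0#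
    remainders p′ x p≃ q′ y q≃ = remainder-zero a (s +ᴾ (-ᴾ u)) (x * y) (begin
      l *ᴾ (s +ᴾ (-ᴾ u))                              ≈⟨ RingProperties.x[y-z]≈xy-xz P.ring l s u ⟩
      l *ᴾ s +ᴾ (-ᴾ (l *ᴾ u))                         ≈⟨ P.+-congʳ ls≃ ⟩
      l *ᴾ u +ᴾ constant (x * y) +ᴾ (-ᴾ (l *ᴾ u))     ≈⟨ xyx⁻¹≈y (l *ᴾ u) (constant (x * y)) ⟩
      constant (x * y)                                ∎)
      where
      open AbelianGroupProperties P.+-abelianGroup using (xyx⁻¹≈y)
      -- The quotient by `l` of the product of the two divided forms, read off from
      -- `division-product`.
      u = p′ *ᴾ (l *ᴾ q′ +ᴾ constant y) +ᴾ constant x *ᴾ q′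
      ls≃ : l *ᴾ s ≃ l *ᴾ u +ᴾ constant (x * y)
      ls≃ = begin
        l *ᴾ s                                                ≈⟨ pq≃ls ⟨
        p *ᴾ q                                                ≈⟨ ≃-* p≃ q≃ ⟩
        (l *ᴾ p′ +ᴾ constant x) *ᴾ (l *ᴾ q′ +ᴾ constant y)    ≈⟨ division-product l p′ (constant x) q′ (constant y) ⟩
        l *ᴾ u +ᴾ constant x *ᴾ constant y                    ≈⟨ P.+-congˡ {l *ᴾ u} (constant-* x y) ⟨
        l *ᴾ u +ᴾ constant (x * y)                            ∎

  -- For `d = 0` the degree bound forces `t`, and with it `p`, to vanish, against `0≉1`. Otherwise
  -- the leading coefficient of `p` is that of `t`.
  monic-quotient : ∀ {d} a p t → Monic d p → p ≃ linear a *ᴾ t → Σ[ e ∈ ℕ ] Monic e t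
  monic-quotient {zero} a p t pm p≃lt = ⊥-elim (0≉1 (trans (sym (at p≃0 0)) (leading pm)))
    where
    t≃0 : t ≃ []
    t≃0 = monic-divides (linear a) t (linear-monic a) (below-cong p≃lt (bound pm))
    p≃0 : p ≃ []
    p≃0 = P.trans p≃lt (P.trans (≃-* (P.refl {linear a}) t≃0) (P.zeroʳ (linear a)))
  monic-quotient {suc d} a p t pm p≃lt = d , monic t-below
    (trans (sym (trans (leading-* 1 d (linear a) t (bound (linear-monic a)) t-below)
      (trans (*-congʳ (leading (linear-monic a))) (*-identityˡ _))))
      (trans (sym (at p≃lt (suc d))) (leading pm)))
    where
    t-below : DegreeBelow (suc d) t
    t-below = monic-divides-below (linear a) t (suc d) (linear-monic a) (below-cong p≃lt (bound pm))

  monic-unit : ∀ {d} p → Monic d p → p ≃ constant 1# → d ≡ 0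
  monic-unit {zero}  p pm p≃1 = ≡.refl
  monic-unit {suc d} p pm p≃1 = ⊥-elim (0≉1 (trans (sym (at p≃1 (suc d))) (leading pm)))

  monic-0⇒1 : ∀ p → Monic 0 p → p ≃ constant 1#
  monic-0⇒1 p pm = coeffwise λ { zero → leading pm ; (suc k) → bound pm (suc k) (s≤s z≤n) }

  Splitting : List Carrier → Poly → Poly → Set (c ⊔ ℓ₁)
  Splitting σ p q = Σ[ μ ∈ List Carrier ] Σ[ ν ∈ List Carrier ]
    (p ≃ fromRoots μ × q ≃ fromRoots ν × σ ↭ μ ++ ν)

  splitting-unit : ∀ {d e} p q → Monic d p → Monic e q → d +ℕ e ≡ 0 → Splitting [] p q
  splitting-unit {zero} {zero} p q pm qm _ = [] , [] , monic-0⇒1 p pm , monic-0⇒1 q qm , ↭-refl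

  splitting-consˡ : ∀ {σ p q} a t → p ≃ linear a *ᴾ t → Splitting σ t q → Splitting (a ∷ σ) p q
  splitting-consˡ a t p≃lt (μ , ν , t≃ , q≃ , σ↭) =
    a ∷ μ , ν , P.trans p≃lt (≃-* (P.refl {linear a}) t≃) , q≃ , ↭-prep a σ↭

  splitting-consʳ : ∀ {σ p q} a t → q ≃ linear a *ᴾ t → Splitting σ p t → Splitting (a ∷ σ) p q
  splitting-consʳ a t q≃lt (μ , ν , p≃ , t≃ , σ↭) =
    μ , a ∷ ν , p≃ , P.trans q≃lt (≃-* (P.refl {linear a}) t≃) ,
    ↭-trans (↭-prep a σ↭) (↭-sym (↭-shift μ ν))

  linear-cancelˡ : ∀ a p q t s → p *ᴾ q ≃ linear a *ᴾ s → p ≃ linear a *ᴾ t → t *ᴾ q ≃ s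
  linear-cancelˡ a p q t s pq≃ls p≃lt = monic-cancel (linear a) (t *ᴾ q) s (linear-monic a) (begin
    linear a *ᴾ (t *ᴾ q)    ≈⟨ *ᴾ-assoc (linear a) t q ⟨
    (linear a *ᴾ t) *ᴾ q    ≈⟨ ≃-* p≃lt (P.refl {q}) ⟨
    p *ᴾ q                  ≈⟨ pq≃ls ⟩
    linear a *ᴾ s           ∎)

  linear-cancelʳ : ∀ a p q t s → p *ᴾ q ≃ linear a *ᴾ s → q ≃ linear a *ᴾ t → p *ᴾ t ≃ s
  linear-cancelʳ a p q t s pq≃ls q≃lt = P.trans (*ᴾ-comm p t)
    (linear-cancelˡ a q p t s (P.trans (*ᴾ-comm q p) pq≃ls) q≃lt)

  -- Recursion on `σ`: its head divides `p` or `q` by primality and is cancelled from that factor.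
  -- Monicity is carried along for the end, where a product equal to 1 forces both factors to be 1.
  split₂ : ∀ σ {d e} p q → Monic d p → Monic e q → p *ᴾ q ≃ fromRoots σ → Splitting σ p q
  split₂ []      p q pm qm eq = splitting-unit p q pm qm (monic-unit (p *ᴾ q) (monic-* p q pm qm) eq)
  split₂ (a ∷ σ) p q pm qm eq = Sum.[ divides-p , divides-q ]′ (linear-prime a p q (fromRoots σ) eq)
    where
    divides-p : Σ[ t ∈ Poly ] p ≃ linear a *ᴾ t → Splitting (a ∷ σ) p q
    divides-p (t , p≃lt) = splitting-consˡ a t p≃lt
      (split₂ σ t q (proj₂ (monic-quotient a p t pm p≃lt)) qm (linear-cancelˡ a p q t (fromRoots σ) eq p≃lt))
    divides-q : Σ[ t ∈ Poly ] q ≃ linear a *ᴾ t → Splitting (a ∷ σ) p q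
    divides-q (t , q≃lt) = splitting-consʳ a t q≃lt
      (split₂ σ p t pm (proj₂ (monic-quotient a q t qm q≃lt)) (linear-cancelʳ a p q t (fromRoots σ) eq q≃lt))

  product-monic : ∀ {n} {d : Vector ℕ n} (p : Vector Poly n) → (∀ i → Monic (d i) (p i)) →
    Monic (total d) (product p)
  product-monic {zero}  p pm = monic-1
  product-monic {suc n} p pm = monic-* (p zero) (product (p ∘ suc)) (pm zero) (product-monic (p ∘ suc) (pm ∘ suc))

  split : ∀ {n} {d : Vector ℕ n} σ (p : Vector Poly n) → (∀ i → Monic (d i) (p i)) → product p ≃ fromRoots σ →
    Σ[ μ ∈ (Fin n → List Carrier) ] (∀ i → p i ≃ fromRoots (μ i)) × σ ↭ concat (tabulate μ)
  split {zero} []      p pm eq = (λ ()) , (λ ()) , ↭-refl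
  split {zero} (a ∷ σ) p pm eq with () ← monic-unit (fromRoots (a ∷ σ)) (fromRoots-monic (a ∷ σ)) (P.sym eq)
  split {suc n} σ p pm eq =
    let (μ₀ , ν , p₀≃ , rest≃ , σ↭) =
          split₂ σ (p zero) (product (p ∘ suc)) (pm zero) (product-monic (p ∘ suc) (pm ∘ suc)) eq
        (μ , p≃ , ν↭) = split ν (p ∘ suc) (pm ∘ suc) rest≃
    in (λ { zero → μ₀ ; (suc i) → μ i }) , (λ { zero → p₀≃ ; (suc i) → p≃ i }) ,
       ↭-trans σ↭ (++⁺ˡ μ₀ ν↭)

-- Degree and adjacency matrices of the rooted product.

module GraphMatrices {c ℓ₁ ℓ₂} (K : OrderedField c ℓ₁ ℓ₂) where
  open OrderedField K hiding (zero; _≤_)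
  open RawMonoidOps +-rawMonoid using () renaming (_×_ to _×ᴺ_)
  open Spectra K
  open Alternation commutativeRing
  open Blocks commutativeRing
  open SemiringSum semiring
    using (sum; sum-cong-≋)
  open SemiringSolver commutativeSemiring using (solve; _:=_; _:+_; _:*_)
  open SetoidReasoning setoid

  length-filter : ∀ {a p} {A : Set a} {P : Pred A p} (P? : Decidable P) {n} (f : Fin n → A) →
    length (filter P? (tabulate f)) ×ᴺ 1# ≈ sum (λ i → indicator (does (P? (f i))))
  length-filter P? {zero}  f = refl
  length-filter P? {suc n} f with does (P? (f zero))
  ... | true  = +-congˡ (length-filter P? (f ∘ suc))
  ... | false = trans (length-filter P? (f ∘ suc)) (sym (+-identityˡ _))

  -- Degrees become row sums of the adjacency matrix, so those of the rooted product follow from its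
  -- adjacency entries without counting neighbours.
  degree-sum : ∀ {n} (G : Graph n) i → Graph.degree G i ×ᴺ 1# ≈ sum (adjacencyMatrix G i)
  degree-sum G i = length-filter (Graph.Adj? G i) (λ j → j)

  degreeMatrix-diagonal : ∀ {n} (G : Graph n) i j →
    degreeMatrix G i j ≈ identity i j * sum (adjacencyMatrix G i)
  degreeMatrix-diagonal G i j with does (i ≟ j)
  ... | true  = trans (degree-sum G i) (sym (*-identityˡ _))
  ... | false = sym (zeroˡ _)

  A-sym : ∀ {n} α (G : Graph n) i j → A[ α ] G i j ≈ A[ α ] G j i
  A-sym α G i j = +-cong (*-congˡ degrees) (*-congˡ (reflexive (≡.cong indicator
    (does-⇔ (mk⇔ (Graph.symm G) (Graph.symm G)) (Graph.Adj? G i j) (Graph.Adj? G j i)))))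
    where
    degrees : degreeMatrix G i j ≈ degreeMatrix G j i
    degrees with i ≟ j
    ... | yes ≡.refl = reflexive
      (≡.cong (λ b → if b then Graph.degree G i ×ᴺ 1# else 0#) (≡.sym (dec-true (i ≟ i) ≡.refl)))
    ... | no  i≢j = reflexive
      (≡.cong (λ b → if b then Graph.degree G j ×ᴺ 1# else 0#) (≡.sym (dec-false (j ≟ i) (i≢j ∘ ≡.sym))))

  indicator-∧ : ∀ a b → indicator (a ∧ b) ≈ indicator a * indicator b
  indicator-∧ true  b = sym (*-identityˡ _)
  indicator-∧ false b = sym (zeroˡ _)

  indicator-∨ : ∀ a b → a ∧ b ≡ false → indicator (a ∨ b) ≈ indicator a + indicator b
  indicator-∨ true  false _ = sym (+-identityʳ _)
  indicator-∨ false b     _ = sym (+-identityˡ _)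

  E-product : ∀ {m} h k → E {m} h k ≈ identity root h * identity root k
  E-product h k = trans (indicator-∧ (does (h ≟ root)) (does (k ≟ root)))
    (*-cong (identity-sym h root) (identity-sym k root))

  module _ {r m : ℕ} (R : Graph r) (H : Graph (suc m)) where

    private
      n = suc m
      ε : Vector Carrier n
      ε = identity root
      aH = adjacencyMatrix H
      aR = adjacencyMatrix R

    adjacency-rooted : ∀ x y → indicator (does (rootedAdj? R H x y)) ≈ rooted aH aR x y
    adjacency-rooted (i , h) (j , k) = trans
      (indicator-∨ (does (i ≟ j) ∧ does (Graph.Adj? H h k)) (does (Graph.Adj? R i j) ∧ roots) disjoint)
      (+-cong (indicator-∧ (does (i ≟ j)) (does (Graph.Adj? H h k)))
        (trans (indicator-∧ (does (Graph.Adj? R i j)) roots) (*-congˡ (E-product h k))))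
      where
      roots : Bool
      roots = does ((h ≟ root) ×-dec (k ≟ root))
      -- Edges inside a copy of `H` require `i ≡ j`, whereas irreflexivity of `R` excludes this for
      -- edges between roots. Hence the indicator of the disjunction is a sum.
      disjoint : (does (i ≟ j) ∧ does (Graph.Adj? H h k)) ∧ (does (Graph.Adj? R i j) ∧ roots) ≡ false
      disjoint with i ≟ j
      ... | no  _ = ≡.refl
      ... | yes ≡.refl rewrite dec-false (Graph.Adj? R i i) (Graph.irrefl R ≡.refl) = ∧-zeroʳ _

    sum-rooted : ∀ i h → sum (λ j → sum λ k → rooted aH aR (i , h) (j , k)) ≈ sum (aH h) + ε h * sum (aR i)
    sum-rooted i h = begin
      sum (λ j → sum λ k → identity i j * aH h k + aR i j * (ε h * ε k))
        ≈⟨ sum-cong-≋ (λ j → inner j) ⟩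
      sum (λ j → ε h * aR i j + identity i j * sum (aH h))
        ≈⟨ sum-linear (ε h) {g = aR i} {h = λ j → identity i j * sum (aH h)} (λ j → refl) ⟩
      ε h * sum (aR i) + sum (λ j → identity i j * sum (aH h))
        ≈⟨ +-comm _ _ ⟩
      sum (λ j → identity i j * sum (aH h)) + ε h * sum (aR i)
        ≈⟨ +-congʳ (sum-indicator i (λ _ → sum (aH h))) ⟩
      sum (aH h) + ε h * sum (aR i) ∎
      where
      inner : ∀ j → sum (λ k → identity i j * aH h k + aR i j * (ε h * ε k)) ≈
        ε h * aR i j + identity i j * sum (aH h)
      inner j = begin
        sum (λ k → identity i j * aH h k + aR i j * (ε h * ε k))
          ≈⟨ sum-linear (identity i j) {g = aH h} {h = λ k → ε k * (ε h * aR i j)} (λ k → +-congˡ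
               (solve 3 (λ a x y → a :* (x :* y) := y :* (x :* a)) refl (aR i j) (ε h) (ε k))) ⟩
        identity i j * sum (aH h) + sum (λ k → ε k * (ε h * aR i j))
          ≈⟨ +-congˡ (sum-indicator (root {m}) (λ _ → ε h * aR i j)) ⟩
        identity i j * sum (aH h) + ε h * aR i j
          ≈⟨ +-comm _ _ ⟩
        ε h * aR i j + identity i j * sum (aH h) ∎

    -- On the diagonal, the contribution of `R` to a degree lives at the root only, so it is a
    -- multiple of the matrix `E`. This places D(R) next to A(R) in the summand carried by `E`.
    identity-root : ∀ h k → identity h k * ε h ≈ ε h * ε k
    identity-root h k with root {m} ≟ h
    ... | yes ≡.refl = trans (*-identityʳ _) (sym (*-identityˡ _))
    ... | no  _      = trans (zeroʳ _) (sym (zeroˡ _))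

    A-rooted : ∀ α p q → A[ α ] (R ｛ H ｝) p q ≈ flatten (rooted (A[ α ] H) (A[ α ] R)) p q
    A-rooted α p q = begin
      α * degreeMatrix (R ｛ H ｝) p q + (1# - α) * adjacencyMatrix (R ｛ H ｝) p q
        ≈⟨ +-cong (*-congˡ degrees) (*-congˡ (adjacency-rooted (remQuot {r} n p) (remQuot {r} n q))) ⟩
      α * (d * e * (x + ε h * y)) + (1# - α) * (d * aH h k + aR i j * (ε h * ε k))
        ≈⟨ +-congʳ (solve 6 (λ α d e x w y →
             α :* (d :* e :* (x :+ w :* y)) := α :* (d :* (e :* x)) :+ α :* (d :* y) :* (e :* w))
             refl α d e x (ε h) y) ⟩
      (α * (d * (e * x)) + α * (d * y) * (e * ε h)) + (1# - α) * (d * aH h k + aR i j * (ε h * ε k))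
        ≈⟨ +-congʳ (+-congˡ (*-congˡ (identity-root h k))) ⟩
      (α * (d * (e * x)) + α * (d * y) * (ε h * ε k)) + (1# - α) * (d * aH h k + aR i j * (ε h * ε k))
        -- The solver works in a semiring, so `1# - α` enters as the atom `β`; `ex` and `w`
        -- abbreviate the products `e * x` and `ε h * ε k`.
        ≈⟨ solve 8 (λ α β d ex y w a b → (α :* (d :* ex) :+ α :* (d :* y) :* w) :+ β :* (d :* a :+ b :* w) :=
             d :* (α :* ex :+ β :* a) :+ (α :* (d :* y) :+ β :* b) :* w)
             refl α (1# - α) d (e * x) y (ε h * ε k) (aH h k) (aR i j) ⟩
      d * (α * (e * x) + (1# - α) * aH h k) + (α * (d * y) + (1# - α) * aR i j) * (ε h * ε k)
        ≈⟨ +-cong (*-congˡ (+-congʳ (*-congˡ (degreeMatrix-diagonal H h k))))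
             (*-congʳ (+-congʳ (*-congˡ (degreeMatrix-diagonal R i j)))) ⟨
      d * A[ α ] H h k + A[ α ] R i j * (ε h * ε k) ∎
      where
      i = proj₁ (remQuot {r} n p)
      h = proj₂ (remQuot {r} n p)
      j = proj₁ (remQuot {r} n q)
      k = proj₂ (remQuot {r} n q)
      d = identity i j
      e = identity h k
      x = sum (aH h)
      y = sum (aR i)
      degrees : degreeMatrix (R ｛ H ｝) p q ≈ d * e * (x + ε h * y)
      degrees = trans (degreeMatrix-diagonal (R ｛ H ｝) p q) (*-cong (identity-flatten {r} {n} p q)
        (trans (trans (sum-cong-≋ λ q → adjacency-rooted (remQuot {r} n p) (remQuot {r} n q))
          (sum-remQuot {r} {n} (rooted aH aR (remQuot {r} n p)))) (sum-rooted i h)))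

-- Characteristic matrices over an abstract extension ring.

module Characteristic {c ℓ c′ ℓ′} (K : CommutativeRing c ℓ) (S : CommutativeRing c′ ℓ′)
  (ι : CommutativeRing.Carrier K → CommutativeRing.Carrier S)
  (ι-hom : IsRingHomomorphism (CommutativeRing.rawRing K) (CommutativeRing.rawRing S) ι)
  (x : CommutativeRing.Carrier S) where

  private
    module K where
      open CommutativeRing K public
      open Alternation K using (identity) public
      open Blocks K using (rooted) public
  open Polynomial K
  open PolynomialRing K using (module Det; DegreeBelow; at; fromRoots; _≃_)
  open CommutativeRing S hiding (zero)
  open Determinant rawRing
  open Alternation S
  open Blocks S
  open SemiringExp semiring using (_^_)
  open IsRingHomomorphism ι-hom
  open RingProperties ring using (-‿distribˡ-*; -‿distribʳ-*; -‿+-comm)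
  open SemiringSolver commutativeSemiring using (solve; _:=_; _:+_; _:*_)
  open SetoidReasoning setoid

  -- This becomes X I - A when `ι` is `constant` and `x` is `X`. With `S` abstract, polynomials stay
  -- opaque in the calculations.
  characteristic : ∀ {n} → Matrix K.Carrier n → Matrix Carrier n
  characteristic A i j = identity i j * x + - ι (A i j)

  ι-identity : ∀ {n} (i j : Fin n) → ι (K.identity i j) ≈ identity i j
  ι-identity i j with does (i ≟ j)
  ... | true  = 1#-homo
  ... | false = 0#-homo

  module _ {m : ℕ} (A : Matrix K.Carrier (suc m)) where

    private
      n = suc m
      ε : Vector Carrier n
      ε = identity root
      P : Matrix Carrier n
      P = characteristic A
      f g : Carrier
      f = det P
      g = det (P [ root ]≔ ε)

    ι-root : ∀ a (h k : Fin n) →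
      ι (a K.* (K.identity root h K.* K.identity root k)) ≈ ι a * (ε h * ε k)
    ι-root a h k = trans (*-homo a _) (*-congˡ (trans (*-homo _ _) (*-cong (ι-identity root h) (ι-identity root k))))

    -- The identity on pairs is I ⊗ I, so the multiple by `x` is absorbed entirely by the I ⊗ P part
    -- and only the sign reaches `B`.
    characteristic-rooted : ∀ {r} (B : Matrix K.Carrier r) (y z : Pairs r n) →
      identity (proj₁ y) (proj₁ z) * identity (proj₂ y) (proj₂ z) * x + - ι (K.rooted A B y z) ≈
         rooted P (λ i j → - ι (B i j)) y z
    characteristic-rooted B (i , h) (j , k) = begin
      d * e * x + - ι (K.identity i j K.* A h k K.+ B i j K.* (K.identity root h K.* K.identity root k))
        ≈⟨ +-congˡ (-‿cong (trans (+-homo _ _)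
             (+-cong (trans (*-homo _ _) (*-congʳ (ι-identity i j))) (ι-root (B i j) h k)))) ⟩
      d * e * x + - (d * ι (A h k) + ι (B i j) * (ε h * ε k))
        ≈⟨ +-congˡ (-‿+-comm _ _) ⟨
      d * e * x + (- (d * ι (A h k)) + - (ι (B i j) * (ε h * ε k)))
        ≈⟨ +-congˡ (+-cong (-‿distribʳ-* _ _) (-‿distribˡ-* _ _)) ⟩
      d * e * x + (d * - ι (A h k) + - ι (B i j) * (ε h * ε k))
        ≈⟨ solve 5 (λ d e x a b → d :* e :* x :+ (d :* a :+ b) := d :* (e :* x :+ a) :+ b)
             refl d e x (- ι (A h k)) (- ι (B i j) * (ε h * ε k)) ⟩
      d * (e * x + - ι (A h k)) + - ι (B i j) * (ε h * ε k) ∎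
      where
      d = identity i j
      e = identity h k

    characteristic-shift : ∀ a (M : Matrix K.Carrier n) →
      (∀ h k → M h k K.≈ A h k K.+ a K.* (K.identity root h K.* K.identity root k)) →
      det (characteristic M) ≈ f + - (ι a * g)
    characteristic-shift a M eq = begin
      det (characteristic M)
        ≈⟨ det-cong (characteristic M) (λ h k → P h k + - ι a * (ε h * ε k)) entry ⟩
      det (λ h k → P h k + - ι a * (ε h * ε k))
        ≈⟨ det-root-shift P (- ι a) ⟩
      - ι a * g + f
        ≈⟨ +-comm _ _ ⟩
      f + - ι a * g
        ≈⟨ +-congˡ (-‿distribˡ-* _ _) ⟨
      f + - (ι a * g) ∎
      where
      entry : ∀ h k → characteristic M h k ≈ P h k + - ι a * (ε h * ε k)
      entry h k = begin
        identity h k * x + - ι (M h k)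
          ≈⟨ +-congˡ (-‿cong (trans (⟦⟧-cong (eq h k)) (trans (+-homo _ _) (+-congˡ (ι-root a h k))))) ⟩
        identity h k * x + - (ι (A h k) + ι a * (ε h * ε k))
          ≈⟨ +-congˡ (-‿+-comm _ _) ⟨
        identity h k * x + (- ι (A h k) + - (ι a * (ε h * ε k)))
          ≈⟨ +-assoc _ _ _ ⟨
        P h k + - (ι a * (ε h * ε k))
          ≈⟨ +-congˡ (-‿distribˡ-* _ _) ⟩
        P h k + - ι a * (ε h * ε k) ∎

    open Homogenisation K S ι ι-hom f g

    -- det (f I − g B) is the homogenisation in f, g of the characteristic
    -- polynomial of B.
    det-homogenised : ∀ {r} (B : Matrix K.Carrier r) (ρ : Fin r → K.Carrier) →
      Det.det (λ i j → (if does (i ≟ j) then X else []) +ᴾ (-ᴾ constant (B i j))) ≃ fromRoots (tabulate ρ) →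
      det (λ i j → f * identity i j + g * - ι (B i j)) ≈ foldr _*_ 1# (λ i → f + - (ι (ρ i) * g))
    det-homogenised {r} B ρ eq = begin
      det (λ i j → f * identity i j + g * - ι (B i j))
        ≈⟨ det-cong (λ i j → f * identity i j + g * - ι (B i j)) (λ i j → homogenise 1 (coeff (entry i j)))
             homogenise-entry ⟩
      det (λ i j → homogenise 1 (coeff (entry i j)))
        ≈⟨ homogenise-det entry entry-below ⟨
      homogenise r (coeff (Det.det entry))
        ≈⟨ homogenise-cong r (at eq) ⟩
      homogenise r (coeff (fromRoots (tabulate ρ)))
        ≈⟨ reflexive (≡.cong (λ l → homogenise l (coeff (fromRoots (tabulate ρ)))) (≡.sym (length-tabulate ρ))) ⟩
      homogenise (length (tabulate ρ)) (coeff (fromRoots (tabulate ρ)))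
        ≈⟨ homogenise-fromRoots (tabulate ρ) ⟩
      List.foldr (λ a y → (f + - (ι a * g)) * y) 1# (tabulate ρ)
        ≈⟨ foldr-tabulate ρ ⟩
      foldr _*_ 1# (λ i → f + - (ι (ρ i) * g)) ∎
      where
      entry : Matrix Poly r
      entry i j = (if does (i ≟ j) then X else []) +ᴾ (-ᴾ constant (B i j))
      entry-below : ∀ i j → DegreeBelow 2 (entry i j)
      entry-below i j with does (i ≟ j)
      ... | true  = λ { (suc (suc k)) _ → K.refl ; (suc zero) (s≤s ()) }
      ... | false = λ { (suc k) _ → K.refl }
      homogenise-entry : ∀ i j → f * identity i j + g * - ι (B i j) ≈ homogenise 1 (coeff (entry i j))
      homogenise-entry i j with does (i ≟ j)
      ... | true  = trans (+-comm _ _) (+-cong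
        (trans (*-comm _ _) (*-cong
          (trans (sym (-‿homo (B i j))) (⟦⟧-cong (K.sym (K.+-identityˡ _)))) (sym (*-identityʳ g))))
        (*-congˡ (sym 1#-homo)))
      ... | false = trans (+-comm _ _) (+-cong
        (trans (*-comm _ _) (*-cong (sym (-‿homo (B i j))) (sym (*-identityʳ g))))
        (*-congˡ (sym 0#-homo)))
      foldr-tabulate : ∀ {r} (ρ : Fin r → K.Carrier) →
        List.foldr (λ a y → (f + - (ι a * g)) * y) 1# (tabulate ρ) ≈ foldr _*_ 1# (λ i → f + - (ι (ρ i) * g))
      foldr-tabulate {zero}  ρ = refl
      foldr-tabulate {suc r} ρ = *-congˡ (foldr-tabulate (ρ ∘ suc))

    module _ (A-sym : ∀ h k → A h k K.≈ A k h) {r : ℕ}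
      (B : Matrix K.Carrier r) (M : Matrix K.Carrier (r *ℕ n))
      (M-rooted : ∀ p q → M p q K.≈ K.rooted A B (remQuot {r} n p) (remQuot {r} n q))
      where

      det-characteristic-rooted : (ρ : Fin r → K.Carrier) →
        Det.det (λ i j → (if does (i ≟ j) then X else []) +ᴾ (-ᴾ constant (B i j))) ≃ fromRoots (tabulate ρ) →
        g ^ r * det (characteristic M) ≈ g ^ r * foldr _*_ 1# (λ i → f + - (ι (ρ i) * g))
      det-characteristic-rooted ρ eq = begin
        g ^ r * det (characteristic M)
          ≈⟨ *-congˡ (det-cong (characteristic M) (flatten {r} {n} (rooted P C)) entry) ⟩
        g ^ r * det (flatten {r} {n} (rooted P C))
          ≈⟨ det-rooted P P-sym C ⟩
        g ^ r * det (λ i j → f * identity i j + g * C i j)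
          ≈⟨ *-congˡ (det-homogenised B ρ eq) ⟩
        g ^ r * foldr _*_ 1# (λ i → f + - (ι (ρ i) * g)) ∎
        where
        C : Matrix Carrier r
        C i j = - ι (B i j)
        P-sym : ∀ h k → P h k ≈ P k h
        P-sym h k = +-cong (*-congʳ (identity-sym h k)) (-‿cong (⟦⟧-cong (A-sym h k)))
        entry : ∀ p q → characteristic M p q ≈ flatten {r} {n} (rooted P C) p q
        entry p q = trans (+-cong (*-congʳ (identity-flatten {r} {n} p q)) (-‿cong (⟦⟧-cong (M-rooted p q))))
          (characteristic-rooted B (remQuot {r} n p) (remQuot {r} n q))

-- The spectrum of the rooted product.

module RootedSpectrum {c ℓ₁ ℓ₂} (K : OrderedField c ℓ₁ ℓ₂) where
  open OrderedField K hiding (zero; _≤_)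
  open Spectra K
  open Polynomial commutativeRing
  open PolynomialRing commutativeRing hiding (fromRoots)
  open Factorisation K
  open GraphMatrices K
  private
    module P where
      open CommutativeRing polyRing public
      open Alternation polyRing public using (identity; identity-diagonal; identity-off; det-cong)
      open Blocks polyRing public using (_[_]≔_; ≔-updated; ≔-other)
      open SemiringExp (CommutativeRing.semiring polyRing) public using (_^_)

  constant-isRingHomomorphism : IsRingHomomorphism rawRing (CommutativeRing.rawRing polyRing) constant
  constant-isRingHomomorphism = record
    { isSemiringHomomorphism = record
      { isNearSemiringHomomorphism = record
        { +-isMonoidHomomorphism = record
          { isMagmaHomomorphism = record
            { isRelHomomorphism = record { cong = constant-cong }
            ; homo = λ a b → P.refl
            }
          ; ε-homo = constant-0 refl
          }
        ; *-homo = constant-*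
        }
      ; 1#-homo = P.refl
      }
    ; -‿homo = λ a → P.refl
    }

  open Characteristic commutativeRing polyRing constant constant-isRingHomomorphism X

  module _ {n} (M : Matrix Carrier n) where

    entry : Matrix Poly n
    entry i j = (if does (i ≟ j) then X else []) +ᴾ (-ᴾ constant (M i j))

    entry-characteristic : ∀ i j → entry i j ≃ characteristic M i j
    entry-characteristic i j with does (i ≟ j)
    ... | true  = P.+-congʳ { -ᴾ constant (M i j)} (P.sym (P.*-identityˡ X))
    ... | false = P.refl

    entry-diagonal : ∀ i → Monic 1 (entry i i)
    entry-diagonal i with i ≟ i
    ... | yes _   = linear-monic (M i i)
    ... | no  i≢i = ⊥-elim (i≢i ≡.refl)

    entry-off : ∀ {i j} → i ≢ j → DegreeBelow 1 (entry i j)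
    entry-off {i} {j} i≢j with i ≟ j
    ... | yes i≡j = ⊥-elim (i≢j i≡j)
    ... | no  _   = constant-below (- M i j)

    charPoly-det : charPoly M ≡ Det.det entry
    charPoly-det = det-polyRawRing entry

    charPoly-characteristic : charPoly M ≃ Det.det (characteristic M)
    charPoly-characteristic = P.trans (P.reflexive charPoly-det) (P.det-cong entry (characteristic M) entry-characteristic)

    charPoly-monic : Monic (total {n} (const 1)) (charPoly M)
    charPoly-monic = ≡.subst (Monic (total {n} (const 1))) (≡.sym charPoly-det)
      (det-monic entry (const 1) entry-diagonal λ i j → entry-off)

  module _ {m} (A : Matrix Carrier (suc m)) where

    private
      ε : Vector Poly (suc m)
      ε = P.identity root
      B : Matrix Poly (suc m)
      B = characteristic A P.[ root ]≔ ε
      -- The row degrees of `B`: its root row is a constant unit row, the others are rows of X I -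
      -- A.
      d : Vector ℕ (suc m)
      d h = if does (h ≟ root) then 0 else 1

    -- Equivalently, the characteristic polynomial of `A` with the row and column of the root
    -- deleted.
    rootMinor : Poly
    rootMinor = Det.det B

    rootMinor-monic : Monic (total d) rootMinor
    rootMinor-monic = det-monic B d diagonal off
      where
      diagonal : ∀ h → Monic (d h) (B h h)
      diagonal h with h ≟ root
      ... | yes ≡.refl = monic-cong (P.sym (P.trans
              (P.reflexive (≡.cong-app (P.≔-updated (characteristic A) root ε) root))
              (P.identity-diagonal (root {m})))) monic-1
      ... | no h≢root = monic-cong (P.trans (entry-characteristic A h h)
              (P.reflexive (≡.cong-app (≡.sym (P.≔-other (characteristic A) ε h≢root)) h))) (entry-diagonal A h)
      off : ∀ h k → h ≢ k → DegreeBelow (d h) (B h k)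
      off h k h≢k with h ≟ root
      ... | yes ≡.refl = below-cong (P.sym (P.trans
              (P.reflexive (≡.cong-app (P.≔-updated (characteristic A) root ε) k))
              (P.identity-off h≢k))) (λ _ _ → refl)
      ... | no h≢root = below-cong (P.trans (entry-characteristic A h k)
              (P.reflexive (≡.cong-app (≡.sym (P.≔-other (characteristic A) ε h≢root)) k))) (entry-off A h≢k)

  monic-^ : ∀ {d p} r → Monic d p → Monic (total {r} (const d)) (p P.^ r)
  monic-^ zero            pm = monic-1
  monic-^ {p = p} (suc r) pm = monic-* p (p P.^ r) pm (monic-^ r pm)

  module _ {r m : ℕ} (R : Graph r) (H : Graph (suc m)) (α : Carrier)
    (ρ : Fin r → Carrier) (specR : IsSpec (A[ α ] R) (tabulate ρ)) where

    private
      shifted : Fin r → Matrix Carrier (suc m)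
      shifted j = A[ α ] H +ᴹ ρ j ·ᴹ E
      g : Poly
      g = rootMinor (A[ α ] H)

    charPoly-rooted : charPoly (A[ α ] (R ｛ H ｝)) ≃ product (charPoly ∘ shifted)
    charPoly-rooted = monic-cancel (g P.^ r) _ _ (monic-^ r (rootMinor-monic (A[ α ] H))) (begin
      (g P.^ r) *ᴾ charPoly (A[ α ] (R ｛ H ｝))
        ≈⟨ ≃-* (P.refl {g P.^ r}) (charPoly-characteristic (A[ α ] (R ｛ H ｝))) ⟩
      (g P.^ r) *ᴾ Det.det (characteristic (A[ α ] (R ｛ H ｝)))
        ≈⟨ det-characteristic-rooted (A[ α ] H) (A-sym α H) (A[ α ] R) (A[ α ] (R ｛ H ｝)) (A-rooted R H α) ρ
             (P.trans (P.reflexive (≡.sym (charPoly-det (A[ α ] R)))) (coeffwise specR)) ⟩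
      (g P.^ r) *ᴾ product (λ j → Det.det (characteristic (A[ α ] H)) +ᴾ (-ᴾ (constant (ρ j) *ᴾ g)))
        ≈⟨ ≃-* (P.refl {g P.^ r}) (product-cong λ j → P.trans (charPoly-characteristic (shifted j))
             (characteristic-shift (A[ α ] H) (ρ j) (shifted j) (λ h k → +-congˡ (*-congˡ (E-product h k))))) ⟨
      (g P.^ r) *ᴾ product (charPoly ∘ shifted) ∎)
      where open SetoidReasoning P.setoid

    -- Forwards, the lists `μ j` are produced by distributing `σ` over the monic factors, so their
    -- existence is part of the conclusion. Backwards, the product of the factors is the polynomial
    -- of the concatenated list.
    rooted-spectrum : ∀ σ → IsSpec (A[ α ] (R ｛ H ｝)) σ ⇔
      (Σ[ μ ∈ (Fin r → List Carrier) ] (∀ j → IsSpec (shifted j) (μ j)) × σ ↭ concat (tabulate μ))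
    rooted-spectrum σ = mk⇔ to from
      where
      Factored : Set _
      Factored = Σ[ μ ∈ (Fin r → List Carrier) ] (∀ j → IsSpec (shifted j) (μ j)) × σ ↭ concat (tabulate μ)
      to : IsSpec (A[ α ] (R ｛ H ｝)) σ → Factored
      to spec =
        let (μ , μ≃ , σ↭) = split σ (charPoly ∘ shifted) (charPoly-monic ∘ shifted)
              (P.trans (P.sym charPoly-rooted) (coeffwise spec))
        in μ , (λ j → at (μ≃ j)) , σ↭
      from : Factored → IsSpec (A[ α ] (R ｛ H ｝)) σ
      from (μ , specs , σ↭) = at (P.trans charPoly-rooted
        (P.trans (product-cong λ j → coeffwise (specs j))
          (P.trans (P.sym (fromRoots-concat μ)) (P.sym (fromRoots-↭ σ↭)))))

theorem1 : ∀ {c ℓ₁ ℓ₂} (K : OrderedField c ℓ₁ ℓ₂) →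
    let open OrderedField K
        open Spectra K
    in
    ∀ {r m : ℕ} (R : Graph r) → Connected R → (H : Graph (suc m)) →
    (α : Carrier) → 0# ≤ α → α ≤ 1# →
    (ρ : Fin r → Carrier) → IsSpec (A[ α ] R) (tabulate ρ) →
    (σ : List Carrier) →
    IsSpec (A[ α ] (R ｛ H ｝)) σ
      ⇔
    (Σ[ μ ∈ (Fin r → List Carrier) ]
       (∀ j → IsSpec (A[ α ] H +ᴹ ρ j ·ᴹ E) (μ j)) × σ ↭ concat (tabulate μ))
theorem1 K R _ H α _ _ ρ specR = RootedSpectrum.rooted-spectrum K R H α ρ specR
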